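{- Let $D$ be a strongly connected balanced bipartite digraph of order $2a$, where $a\geq 2$. Suppose that for every dominated pair $\{u,v\}$ of vertices in $D$, \[ d(u)+d(v)\geq 3a+1. \] Then $D$ is hamiltonian.
   Context: Digraphs have no loops and no multiple arcs. For a vertex $v$, $d(v)=d^+(v)+d^-(v)$ (out-degree plus in-degree). A pair of distinct vertices $\{u,v\}$ is dominated if there is a vertex $w$ with $wu$ and $wv$ both arcs of $D$. Balanced bipartite: two partite sets of equal size. Hamiltonian: contains a directed cycle through all vertices. -}

module Defs where

open import Data.Nat using (ℕ; zero; suc; _+_; _*_)
open import Data.Bool using (Bool; true; false; not)
open import Data.Fin using (Fin; zero; suc)
open import Data.List using (List; []; _∷_; _++_)
open import Data.List.Membership.Propositional using (_∈_)
open import Data.List.Relation.Unary.Unique.Propositional using (Unique)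
open import Data.Unit using (⊤)
open import Data.Product using (Σ; ∃; _×_; _,_)
open import Relation.Binary.PropositionalEquality using (_≡_; _≢_)

record Digraph (n : ℕ) : Set where
  field
    arc      : Fin n → Fin n → Bool
    loopless : ∀ v → arc v v ≡ false
open Digraph public

count : ∀ {n} → (Fin n → Bool) → ℕ
count {zero}  f = 0
count {suc n} f with f zero
... | true  = suc (count (λ i → f (suc i)))
... | false = count (λ i → f (suc i))

outdeg : ∀ {n} → Digraph n → Fin n → ℕ
outdeg D v = count (λ w → arc D v w)

indeg : ∀ {n} → Digraph n → Fin n → ℕ
indeg D v = count (λ w → arc D w v)

deg : ∀ {n} → Digraph n → Fin n → ℕ
deg D v = outdeg D v + indeg D v

BalancedBipartite : ∀ {n} → Digraph n → ℕ → Set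
BalancedBipartite {n} D a =
  Σ (Fin n → Bool) λ side →
    (∀ u v → arc D u v ≡ true → side u ≢ side v)
    × count side ≡ a
    × count (λ v → not (side v)) ≡ a

data Reach {n} (D : Digraph n) : Fin n → Fin n → Set where
  here : ∀ {u} → Reach D u u
  step : ∀ {u w v} → arc D u w ≡ true → Reach D w v → Reach D u v

StronglyConnected : ∀ {n} → Digraph n → Set
StronglyConnected D = ∀ u v → Reach D u v

Dominated : ∀ {n} → Digraph n → Fin n → Fin n → Set
Dominated D u v = u ≢ v × ∃ λ w → arc D w u ≡ true × arc D w v ≡ true

ArcPath : ∀ {n} → Digraph n → List (Fin n) → Set
ArcPath D []           = ⊤
ArcPath D (x ∷ [])     = ⊤
ArcPath D (x ∷ y ∷ vs) = arc D x y ≡ true × ArcPath D (y ∷ vs)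

Hamiltonian : ∀ {n} → Digraph n → Set
Hamiltonian {n} D =
  Σ (Fin n) λ v₀ → Σ (List (Fin n)) λ rest →
    Unique (v₀ ∷ rest)
    × (∀ v → v ∈ (v₀ ∷ rest))
    × ArcPath D (v₀ ∷ rest ++ v₀ ∷ [])

{-
If a vertex lies in no dominated pair, then all its in-neighbours have outdegree 1 and lie in no dominated
pair either; by strong connectivity every outdegree is then 1 and D is a directed cycle.  So assume that
every vertex lies in a dominated pair, whence all degrees are at least a + 1.

By Hall's theorem D has a cycle factor σ: an arc-free pair (X, Y) on opposite sides with |X| + |Y| > a would
leave no dominated pair inside X or none inside Y, and the few arcs entering that set contradict the degrees.

Let B be a σ-orbit that is not everything, and S the smaller of B and its complement, with c ≤ a / 2 vertices
on each side.  If u → σ w and w → σ u for some u in S and w outside, exchanging σ u and σ w enlarges the orbit.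
Otherwise out v + in (σ v) exceeds the part inside S by at most a − c for every v in S, so the degrees in S
sum to at most 2 e(S) + 2 c (a − c).  For c ≥ 2 this is too small on one side: the light vertices
(2 d ≤ 3 a) have disjoint in-neighbourhoods, so many of them make e(S) small and few of them leave the
degree sum large.  For c = 1 equality is forced, and then partners of degree 2 a provide the exchange.
-}
module Submission where

open import Defs
open import Data.Bool using (Bool; true; false; not; _∧_; _∨_)
import Data.Bool.Properties as Bool
open import Data.Empty using (⊥; ⊥-elim)
open import Data.Fin using (Fin; zero; suc; toℕ; fromℕ<)
open import Data.Fin.Permutation
  using (Permutation′; _⟨$⟩ʳ_; _⟨$⟩ˡ_; inverseˡ; inverseʳ; transpose; _∘ₚ_) renaming (id to idₚ)
open import Data.Fin.Properties using (_≟_; any?; toℕ-fromℕ<; toℕ-injective; toℕ<n; pigeonhole; injective⇒≤)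
open import Data.List as List using (List; []; _∷_; _++_; tabulate)
open import Data.List.Membership.Propositional using (_∈_)
open import Data.List.Membership.Propositional.Properties using (∈-tabulate⁺)
open import Data.List.Relation.Unary.Unique.Propositional using (Unique)
import Data.List.Relation.Unary.Unique.Propositional.Properties as Unique
open import Data.Nat using (ℕ; zero; suc; _+_; _*_; _≤_; _<_; z≤n; s≤s; _≤?_; _<?_)
open import Data.Nat.GeneralisedArithmetic using (iterate)
open import Data.Nat.Properties hiding (_≟_; _≤?_; _<?_)
open import Data.Nat.Tactic.RingSolver using (solve-∀)
open import Data.Product using (∃; ∃₂; _×_; _,_; proj₁; proj₂)
open import Data.Sum using (_⊎_; inj₁; inj₂)
open import Function using (_∘_)
open import Relation.Binary using (tri<; tri≈; tri>)
open import Relation.Binary.Construct.Closure.ReflexiveTransitive using (Star; ε; _◅_; _◅◅_)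
open import Relation.Binary.PropositionalEquality
open import Relation.Nullary using (¬_; Dec; yes; no; does; ¬?)
open import Relation.Nullary.Decidable using (_×-dec_; dec-true; dec-false; decidable-stable)
open import Algebra.Properties.CommutativeMonoid.Sum +-0-commutativeMonoid
  using (sum; sum-cong-≗; ∑-distrib-+; ∑-comm; sum-permute)

-- Booleans and linear inequalities

private variable
  n : ℕ

true≢false : ∀ {b} → b ≡ true → b ≡ false → ⊥
true≢false refl ()

¬false⇒true : ∀ {b} → ¬ (b ≡ false) → b ≡ true
¬false⇒true {true} _ = refl
¬false⇒true {false} h = ⊥-elim (h refl)

∧-intro : ∀ {b c} → b ≡ true → c ≡ true → b ∧ c ≡ true
∧-intro refl refl = refl

∧-elim : ∀ {b c} → b ∧ c ≡ true → b ≡ true × c ≡ true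
∧-elim {true} {true} _ = refl , refl

-- Hypotheses are added up to `x ≤ y`, while the ring solver certifies that `x` exceeds `y` by
-- `1 + s`.
≤-absurd : ∀ {x y} s → x ≡ suc (y + s) → x ≤ y → ⊥
≤-absurd {x} {y} s refl x≤y = <⇒≱ (s≤s (m≤m+n y s)) x≤y

-- The same device for deriving an inequality: `p + x ≤ p + y ≤ q + x`, the second step having slack
-- `s`.
≤-from : ∀ {x y p q} s → x ≤ y → p + y + s ≡ q + x → p ≤ q
≤-from {x} {y} {p} {q} s x≤y eq = +-cancelʳ-≤ x p q
  (≤-trans (+-monoʳ-≤ p x≤y) (≤-trans (m≤m+n (p + y) s) (≤-reflexive eq)))

-- Sums and cardinalities of Boolean subsets

⟦_⟧ : Bool → ℕ
⟦ true ⟧ = 1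
⟦ false ⟧ = 0

⟦⟧-∧ : ∀ b c → ⟦ b ∧ c ⟧ ≡ ⟦ b ⟧ * ⟦ c ⟧
⟦⟧-∧ true c = sym (+-identityʳ ⟦ c ⟧)
⟦⟧-∧ false c = refl

⟦⟧+⟦not⟧ : ∀ b → ⟦ b ⟧ + ⟦ not b ⟧ ≡ 1
⟦⟧+⟦not⟧ true = refl
⟦⟧+⟦not⟧ false = refl

opaque
  ∑ : (Fin n → ℕ) → ℕ
  ∑ = sum

  ∣_∣ : (Fin n → Bool) → ℕ
  ∣_∣ = count

  ∣∣≡count : (P : Fin n → Bool) → ∣ P ∣ ≡ count P
  ∣∣≡count P = refl

  ∑-cong : {f g : Fin n → ℕ} → (∀ v → f v ≡ g v) → ∑ f ≡ ∑ g
  ∑-cong = sum-cong-≗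

  ∑-+ : (f g : Fin n → ℕ) → ∑ (λ v → f v + g v) ≡ ∑ f + ∑ g
  ∑-+ = ∑-distrib-+

  ∑-swap : (f : Fin n → Fin n → ℕ) → ∑ (λ u → ∑ (λ v → f u v)) ≡ ∑ (λ v → ∑ (λ u → f u v))
  ∑-swap = ∑-comm

  ∑-permute : (f : Fin n → ℕ) (σ : Permutation′ n) → ∑ (λ v → f (σ ⟨$⟩ʳ v)) ≡ ∑ f
  ∑-permute f σ = sym (sum-permute f σ)

  ∑-mono : {f g : Fin n → ℕ} → (∀ v → f v ≤ g v) → ∑ f ≤ ∑ g
  ∑-mono {zero} h = z≤n
  ∑-mono {suc n} h = +-mono-≤ (h zero) (∑-mono (h ∘ suc))

  ∑-const : ∀ n k → ∑ {n} (λ _ → k) ≡ n * k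
  ∑-const zero k = refl
  ∑-const (suc n) k = cong (k +_) (∑-const n k)

  ∑-*ʳ : (f : Fin n → ℕ) (k : ℕ) → ∑ (λ v → f v * k) ≡ ∑ f * k
  ∑-*ʳ {zero} f k = refl
  ∑-*ʳ {suc n} f k = trans (cong (f zero * k +_) (∑-*ʳ (f ∘ suc) k)) (sym (*-distribʳ-+ k (f zero) _))

  ∣∣≡∑ : (P : Fin n → Bool) → ∣ P ∣ ≡ ∑ (λ v → ⟦ P v ⟧)
  ∣∣≡∑ {zero} P = refl
  ∣∣≡∑ {suc n} P with P zero
  ... | true = cong suc (∣∣≡∑ (P ∘ suc))
  ... | false = ∣∣≡∑ (P ∘ suc)

∑-*ˡ : (k : ℕ) (f : Fin n → ℕ) → ∑ (λ v → k * f v) ≡ k * ∑ f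
∑-*ˡ k f = trans (∑-cong (λ v → *-comm k (f v))) (trans (∑-*ʳ f k) (*-comm (∑ f) k))

∣∣-cong : {P Q : Fin n → Bool} → (∀ v → P v ≡ Q v) → ∣ P ∣ ≡ ∣ Q ∣
∣∣-cong h = trans (∣∣≡∑ _) (trans (∑-cong (cong ⟦_⟧ ∘ h)) (sym (∣∣≡∑ _)))

∣∣-mono : {P Q : Fin n → Bool} → (∀ v → P v ≡ true → Q v ≡ true) → ∣ P ∣ ≤ ∣ Q ∣
∣∣-mono {P = P} {Q} h = subst₂ _≤_ (sym (∣∣≡∑ P)) (sym (∣∣≡∑ Q)) (∑-mono pointwise)
  where
  pointwise : ∀ v → ⟦ P v ⟧ ≤ ⟦ Q v ⟧
  pointwise v with P v in eq
  ... | false = z≤n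
  ... | true rewrite h v eq = ≤-refl

∣∣-permute : (P : Fin n → Bool) (σ : Permutation′ n) → ∣ (λ v → P (σ ⟨$⟩ʳ v)) ∣ ≡ ∣ P ∣
∣∣-permute P σ = trans (∣∣≡∑ _) (trans (∑-permute (⟦_⟧ ∘ P) σ) (sym (∣∣≡∑ P)))

∣∣-split : (P Q : Fin n → Bool) → ∣ P ∣ ≡ ∣ (λ v → P v ∧ Q v) ∣ + ∣ (λ v → P v ∧ not (Q v)) ∣
∣∣-split P Q = begin
  ∣ P ∣                                                              ≡⟨ ∣∣≡∑ P ⟩
  ∑ (λ v → ⟦ P v ⟧)                                                  ≡⟨ ∑-cong (λ v → split (P v) (Q v)) ⟩
  ∑ (λ v → ⟦ P v ∧ Q v ⟧ + ⟦ P v ∧ not (Q v) ⟧)                      ≡⟨ ∑-+ _ _ ⟩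
  ∑ (λ v → ⟦ P v ∧ Q v ⟧) + ∑ (λ v → ⟦ P v ∧ not (Q v) ⟧)          ≡⟨ cong₂ _+_ (∣∣≡∑ _) (∣∣≡∑ _) ⟨
  ∣ (λ v → P v ∧ Q v) ∣ + ∣ (λ v → P v ∧ not (Q v)) ∣              ∎
  where
  open ≡-Reasoning
  split : ∀ b c → ⟦ b ⟧ ≡ ⟦ b ∧ c ⟧ + ⟦ b ∧ not c ⟧
  split false c = refl
  split true c = sym (⟦⟧+⟦not⟧ c)

∣∣-total : (P : Fin n → Bool) → ∣ P ∣ + ∣ not ∘ P ∣ ≡ n
∣∣-total {n} P = begin
  ∣ P ∣ + ∣ not ∘ P ∣                              ≡⟨ cong₂ _+_ (∣∣≡∑ P) (∣∣≡∑ (not ∘ P)) ⟩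
  ∑ (λ v → ⟦ P v ⟧) + ∑ (λ v → ⟦ not (P v) ⟧)        ≡⟨ ∑-+ _ _ ⟨
  ∑ (λ v → ⟦ P v ⟧ + ⟦ not (P v) ⟧)                    ≡⟨ ∑-cong (λ v → ⟦⟧+⟦not⟧ (P v)) ⟩
  ∑ {n} (λ _ → 1)                                      ≡⟨ ∑-const n 1 ⟩
  n * 1                                                  ≡⟨ *-identityʳ n ⟩
  n                                                      ∎
  where open ≡-Reasoning

｛_｝ : Fin n → Fin n → Bool
｛ x ｝ v = does (x ≟ v)

｛｝-refl : (x : Fin n) → ｛ x ｝ x ≡ true
｛｝-refl x = dec-true (x ≟ x) refl

｛｝-≢ : {x v : Fin n} → x ≢ v → ｛ x ｝ v ≡ false
｛｝-≢ {x = x} {v} = dec-false (x ≟ v)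

｛｝-true : {x v : Fin n} → ｛ x ｝ v ≡ true → x ≡ v
｛｝-true {x = x} {v} h with x ≟ v
... | yes eq = eq

opaque
  unfolding ∑
  ∑-｛｝ : (x : Fin n) (f : Fin n → ℕ) → ∑ (λ v → ⟦ ｛ x ｝ v ⟧ * f v) ≡ f x
  ∑-｛｝ {suc n} zero f = trans (cong₂ _+_ (+-identityʳ (f zero)) (trans (∑-const n 0) (*-zeroʳ n))) (+-identityʳ (f zero))
  ∑-｛｝ {suc n} (suc x) f = ∑-｛｝ x (f ∘ suc)

∣∣-｛｝ : (x : Fin n) → ∣ ｛ x ｝ ∣ ≡ 1
∣∣-｛｝ x = trans (∣∣≡∑ ｛ x ｝)
  (trans (∑-cong (λ v → sym (*-identityʳ ⟦ ｛ x ｝ v ⟧))) (∑-｛｝ x (λ _ → 1)))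

insert : Fin n → (Fin n → Bool) → Fin n → Bool
insert x P v = ｛ x ｝ v ∨ P v

insert-⊇ : (x : Fin n) (P : Fin n → Bool) → ∀ v → P v ≡ true → insert x P v ≡ true
insert-⊇ x P v h rewrite h = Bool.∨-zeroʳ (｛ x ｝ v)

insert-elim : (x : Fin n) (P : Fin n → Bool) → ∀ v → insert x P v ≡ true → x ≡ v ⊎ P v ≡ true
insert-elim x P v h with x ≟ v
... | yes eq = inj₁ eq
... | no _ = inj₂ h

∣∣-insert : (x : Fin n) (P : Fin n → Bool) → P x ≡ false → ∣ insert x P ∣ ≡ suc (∣ P ∣)
∣∣-insert x P Px = begin
  ∣ insert x P ∣                                     ≡⟨ ∣∣≡∑ _ ⟩
  ∑ (λ v → ⟦ insert x P v ⟧)                           ≡⟨ ∑-cong pointwise ⟩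
  ∑ (λ v → ⟦ ｛ x ｝ v ⟧ + ⟦ P v ⟧)                    ≡⟨ ∑-+ _ _ ⟩
  ∑ (λ v → ⟦ ｛ x ｝ v ⟧) + ∑ (λ v → ⟦ P v ⟧)        ≡⟨ cong₂ _+_ (∣∣≡∑ ｛ x ｝) (∣∣≡∑ P) ⟨
  ∣ ｛ x ｝ ∣ + ∣ P ∣                                ≡⟨ cong (_+ ∣ P ∣) (∣∣-｛｝ x) ⟩
  suc (∣ P ∣)                                          ∎
  where
  open ≡-Reasoning
  pointwise : ∀ v → ⟦ insert x P v ⟧ ≡ ⟦ ｛ x ｝ v ⟧ + ⟦ P v ⟧
  pointwise v with x ≟ v
  ... | yes refl rewrite Px = refl
  ... | no _ = refl

∣∣-empty : {P : Fin n → Bool} → (∀ v → P v ≡ false) → ∣ P ∣ ≡ 0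
∣∣-empty {n} {P} empty = trans (∣∣≡∑ P) (trans (∑-cong (λ v → cong ⟦_⟧ (empty v))) (trans (∑-const n 0) (*-zeroʳ n)))

∣∣-≤1 : {P : Fin n → Bool} → (∀ u v → P u ≡ true → P v ≡ true → u ≡ v) → ∣ P ∣ ≤ 1
∣∣-≤1 {P = P} h with any? (λ u → P u Bool.≟ true)
... | yes (u , Pu) = ≤-trans (∣∣-mono (λ v Pv → trans (cong ｛ u ｝ (sym (h u v Pu Pv))) (｛｝-refl u)))
                             (≤-reflexive (∣∣-｛｝ u))
... | no none = ≤-trans (≤-reflexive (∣∣-empty (λ v → Bool.¬-not (λ Pv → none (v , Pv))))) z≤n

member : {P : Fin n → Bool} → 1 ≤ ∣ P ∣ → ∃ λ v → P v ≡ true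
member {P = P} h with any? (λ v → P v Bool.≟ true)
... | yes found = found
... | no none = ⊥-elim (<⇒≱ h (≤-reflexive (∣∣-empty (λ v → Bool.¬-not (λ Pv → none (v , Pv))))))

other-member : {P : Fin n → Bool} → 2 ≤ ∣ P ∣ → ∀ x → ∃ λ v → x ≢ v × P v ≡ true
other-member {P = P} h x with any? (λ v → (｛ x ｝ v Bool.≟ false) ×-dec (P v Bool.≟ true))
... | yes (v , x≢v , Pv) = v , (λ eq → true≢false (trans (cong ｛ x ｝ (sym eq)) (｛｝-refl x)) x≢v) , Pv
... | no none = ⊥-elim (<⇒≱ h (≤-trans (∣∣-mono (λ v Pv → ¬false⇒true (λ e → none (v , e , Pv))))
                                       (≤-reflexive (∣∣-｛｝ x))))

∣∣-pos : {P : Fin n → Bool} (x : Fin n) → P x ≡ true → 1 ≤ ∣ P ∣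
∣∣-pos {P = P} x Px = ≤-trans (≤-reflexive (sym (∣∣-｛｝ x)))
  (∣∣-mono (λ v h → trans (cong P (sym (｛｝-true h))) Px))

∣∣-≥2 : {P : Fin n → Bool} {x y : Fin n} → x ≢ y → P x ≡ true → P y ≡ true → 2 ≤ ∣ P ∣
∣∣-≥2 {P = P} {x} {y} x≢y Px Py = ≤-trans
  (≤-reflexive (sym (trans (∣∣-insert x ｛ y ｝ (｛｝-≢ (x≢y ∘ sym))) (cong suc (∣∣-｛｝ y)))))
  (∣∣-mono sub)
  where
  sub : ∀ v → insert x ｛ y ｝ v ≡ true → P v ≡ true
  sub v h with insert-elim x ｛ y ｝ v h
  ... | inj₁ refl = Px
  ... | inj₂ e = trans (cong P (sym (｛｝-true e))) Py

-- An element of `Q` missing from `P` could be inserted into `P`, giving `∣ P ∣ < ∣ Q ∣`.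
∣∣-full : {P Q : Fin n → Bool} → (∀ v → P v ≡ true → Q v ≡ true) → ∣ Q ∣ ≤ ∣ P ∣ →
             ∀ v → Q v ≡ true → P v ≡ true
∣∣-full {P = P} {Q} sub le v Qv with P v in Pv
... | true = refl
... | false = ⊥-elim (<⇒≱ (≤-trans (≤-reflexive (sym (∣∣-insert v P Pv))) (∣∣-mono sub′)) le)
  where
  sub′ : ∀ u → insert v P u ≡ true → Q u ≡ true
  sub′ u h with insert-elim v P u h
  ... | inj₁ refl = Qv
  ... | inj₂ Pu = sub u Pu

-- Vertices are added while `E` leads out of the set; the fuel `k` bounds the number of vertices
-- outside. The predicate `P` carries evidence, such as a path, that a Boolean set cannot hold.
closure : (E : Fin n → Fin n → Bool) (P : Fin n → Set) (A : Fin n → Bool) →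
          (∀ v → A v ≡ true → P v) → (∀ u w → P u → E u w ≡ true → P w) →
          ∃ λ B → (∀ v → A v ≡ true → B v ≡ true) × (∀ v → B v ≡ true → P v)
                × (∀ u w → B u ≡ true → E u w ≡ true → B w ≡ true)
closure {n} E P A A⇒P advance = go n A (m≤m+n n (∣ A ∣)) A⇒P
  where
  go : ∀ k (A : Fin n → Bool) → n ≤ k + ∣ A ∣ → (∀ v → A v ≡ true → P v) →
       ∃ λ B → (∀ v → A v ≡ true → B v ≡ true) × (∀ v → B v ≡ true → P v)
             × (∀ u w → B u ≡ true → E u w ≡ true → B w ≡ true)
  go k A k≥ A⇒P with any? (λ u → any? (λ w → (A u Bool.≟ true) ×-dec ((E u w Bool.≟ true) ×-dec (A w Bool.≟ false))))
  ... | no none = A , (λ _ h → h) , A⇒P , λ u w Au Euw → ¬false⇒true (λ Aw → none (u , w , Au , Euw , Aw))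
  go zero A k≥ A⇒P | yes (u , w , Au , Euw , Aw) = ⊥-elim (<⇒≱ n<∣A∣ k≥)
    where
    n<∣A∣ : ∣ A ∣ < n
    n<∣A∣ = subst (∣ A ∣ <_) (∣∣-total A)
      (m<m+n (∣ A ∣) (∣∣-pos {P = not ∘ A} w (cong not Aw)))
  go (suc k) A k≥ A⇒P | yes (u , w , Au , Euw , Aw) with go k (insert w A) bound A′⇒P
    where
    bound : n ≤ k + ∣ insert w A ∣
    bound = ≤-trans k≥ (≤-reflexive (trans (sym (+-suc k (∣ A ∣))) (cong (k +_) (sym (∣∣-insert w A Aw)))))
    A′⇒P : ∀ v → insert w A v ≡ true → P v
    A′⇒P v h with insert-elim w A v h
    ... | inj₁ refl = advance u w (A⇒P u Au) Euw
    ... | inj₂ Av = A⇒P v Av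
  ... | B , A′⊆B , B⇒P , closed = B , (λ v Av → A′⊆B v (insert-⊇ w A v Av)) , B⇒P , closed

-- Hall's theorem

-- `∘ₚ` applies its left factor first, so `x` and `y` exchange images.
swap : Fin n → Fin n → Permutation′ n → Permutation′ n
swap x y σ = transpose x y ∘ₚ σ

swap-fst : (x y : Fin n) (σ : Permutation′ n) → swap x y σ ⟨$⟩ʳ x ≡ σ ⟨$⟩ʳ y
swap-fst x y σ rewrite dec-true (x ≟ x) refl = refl

swap-snd : (x y : Fin n) (σ : Permutation′ n) → swap x y σ ⟨$⟩ʳ y ≡ σ ⟨$⟩ʳ x
swap-snd x y σ with y ≟ x
... | yes refl = refl
... | no _ rewrite dec-true (y ≟ y) refl = refl

swap-other : (x y : Fin n) (σ : Permutation′ n) {v : Fin n} → v ≢ x → v ≢ y → swap x y σ ⟨$⟩ʳ v ≡ σ ⟨$⟩ʳ v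
swap-other x y σ {v} v≢x v≢y rewrite dec-false (v ≟ x) v≢x | dec-false (v ≟ y) v≢y = refl

module Hall {n : ℕ} (R : Fin n → Fin n → Bool) where

  -- A partial matching is encoded as a full permutation whose good vertices are the matched ones.
  Good Bad : Permutation′ n → Fin n → Set
  Good σ v = R v (σ ⟨$⟩ʳ v) ≡ true
  Bad σ v = R v (σ ⟨$⟩ʳ v) ≡ false

  -- Augmenting paths: a step goes from `r` to an image `σ u` along `R` and back to `u` along the
  -- permutation. The index counts these returns.
  data Alternating (σ : Permutation′ n) : ℕ → Fin n → Fin n → Set where
    last : ∀ {r y} → R r y ≡ true → Alternating σ 0 r y
    step : ∀ {k r u y} → R r (σ ⟨$⟩ʳ u) ≡ true → Alternating σ k u y → Alternating σ (suc k) r y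

  snoc : ∀ {σ k r u y} → Alternating σ k r (σ ⟨$⟩ʳ u) → R u y ≡ true → Alternating σ (suc k) r y
  snoc (last e) f = step e (last f)
  snoc (step e p) f = step e (snoc p f)

  -- A path meeting r or u again either survives the swap of r and u or can be shortcut from r.
  transport : ∀ {σ k r u z y} → R r (σ ⟨$⟩ʳ u) ≡ true → Alternating σ k z y →
              Alternating (swap r u σ) k z y ⊎ ∃ λ j → j ≤ k × Alternating σ j r y
  transport e (last f) = inj₁ (last f)
  transport {σ} {suc k} {r} {u} e (step {u = v} f p) with transport e p
  ... | inj₂ (j , j≤k , q) = inj₂ (j , m≤n⇒m≤1+n j≤k , q)
  ... | inj₁ q with v ≟ r | v ≟ u
  ...   | yes refl | _ = inj₂ (k , n≤1+n k , p)
  ...   | no _ | yes refl = inj₂ (suc k , ≤-refl , step e p)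
  ...   | no v≢r | no v≢u =
    inj₁ (step (trans (cong (R _) (swap-other r u σ v≢r v≢u)) f) q)

  Improves : Permutation′ n → Fin n → Set
  Improves σ r = ∃ λ σ′ → (∀ v → Good σ v → Good σ′ v) × Good σ′ r

  swap-good : ∀ {σ r u} → R r (σ ⟨$⟩ʳ u) ≡ true → Good (swap r u σ) r
  swap-good {σ} {r} {u} e = trans (cong (R r) (swap-fst r u σ)) e

  swap-keeps : ∀ {σ r u v} → Bad σ r → v ≢ u → Good σ v → Good (swap r u σ) v
  swap-keeps {σ} {r} {u} {v} bad v≢u good =
    trans (cong (R v) (swap-other r u σ (λ { refl → true≢false good bad }) v≢u)) good

  improve-bad : ∀ {σ r w} → Bad σ r → Bad σ w → R r (σ ⟨$⟩ʳ w) ≡ true → Improves σ r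
  improve-bad {σ} {r} {w} bad-r bad-w e =
    swap r w σ , (λ v good → swap-keeps {σ} bad-r (λ { refl → true≢false good bad-w }) good) , swap-good {σ} e

  -- The defect is pushed along the path. Giving `σ u` to `r` repairs `r`; if this spoils `u`, the
  -- rest of the path, transported through the swap, repairs `u`. Where transport fails, it yields a
  -- shorter path from `r`, so the bound `m` drops in every recursive call.
  improve : ∀ m {k} σ {r w} → k ≤ m → Bad σ r → Bad σ w → Alternating σ k r (σ ⟨$⟩ʳ w) → Improves σ r
  improve m σ k≤m bad-r bad-w (last e) = improve-bad {σ} bad-r bad-w e
  improve (suc m) σ {r} {w} (s≤s k≤m) bad-r bad-w (step {u = u} e p) with R u (σ ⟨$⟩ʳ u) in at-u
  ... | false = improve-bad {σ} bad-r at-u e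
  ... | true with R u (swap r u σ ⟨$⟩ʳ u) in at-u′
  ...   | true = swap r u σ , keep , swap-good {σ} e
    where
    keep : ∀ v → Good σ v → Good (swap r u σ) v
    keep v good with v ≟ u
    ... | yes refl = at-u′
    ... | no v≢u = swap-keeps {σ} bad-r v≢u good
  ...   | false with transport e p
  ...     | inj₂ (j , j≤k , q) = improve m σ (≤-trans j≤k k≤m) bad-r bad-w q
  ...     | inj₁ q with displaced
    where
    -- The owner of the target `σ w` after the swap: `u` if `w` is `r`, and `w` itself otherwise. It
    -- is bad in both cases.
    displaced : ∃ λ w′ → Bad (swap r u σ) w′ × swap r u σ ⟨$⟩ʳ w′ ≡ σ ⟨$⟩ʳ w
    displaced with w ≟ r
    ... | yes refl = u , at-u′ , swap-snd r u σ
    ... | no w≢r = w , trans (cong (R w) same) bad-w , same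
      where
      same : swap r u σ ⟨$⟩ʳ w ≡ σ ⟨$⟩ʳ w
      same = swap-other r u σ w≢r (λ { refl → true≢false at-u bad-w })
  ...       | w′ , bad-w′ , eq with improve m (swap r u σ) k≤m at-u′ bad-w′
                                      (subst (Alternating (swap r u σ) _ u) (sym eq) q)
  ...         | σ″ , keep , good-u = σ″ , keep″ , keep r (swap-good {σ} e)
    where
    keep″ : ∀ v → Good σ v → Good σ″ v
    -- Only `u` could be spoiled by the swap, and the recursive call has repaired it.
    keep″ v good with v ≟ u
    ... | yes refl = good-u
    ... | no v≢u = keep v (swap-keeps {σ} bad-r v≢u good)

  -- Failure of Hall's condition in symmetric form: `T` avoids all neighbours of `S` and has more
  -- than `n - ∣ S ∣` elements.
  Violator : Set
  Violator = ∃₂ λ (S T : Fin n → Bool) →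
    (∀ u y → S u ≡ true → T y ≡ true → R u y ≡ false) × n < ∣ S ∣ + ∣ T ∣

  -- The vertices alternately reachable from r, if all good, form with r a set with too few neighbours.
  improve-or-violate : ∀ σ r → Bad σ r → Improves σ r ⊎ Violator
  improve-or-violate σ r bad
    with closure (λ u w → R u (σ ⟨$⟩ʳ w)) (λ w → ∃ λ k → Alternating σ k r (σ ⟨$⟩ʳ w)) (λ w → R r (σ ⟨$⟩ʳ w))
                 (λ _ e → 0 , last e) (λ u w (k , p) e → suc k , snoc p e)
  ... | U , start , path , closed with any? (λ w → (U w Bool.≟ true) ×-dec (R w (σ ⟨$⟩ʳ w) Bool.≟ false))
  ...   | yes (w , Uw , bad-w) = inj₁ (improve _ σ ≤-refl bad bad-w (proj₂ (path w Uw)))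
  ...   | no none = inj₂ (insert r U , T , no-arc , big)
    where
    T : Fin n → Bool
    T y = not (U (σ ⟨$⟩ˡ y))
    Ur : U r ≡ false
    Ur = Bool.¬-not (λ h → none (r , h , bad))
    no-arc : ∀ u y → insert r U u ≡ true → T y ≡ true → R u y ≡ false
    no-arc u y Su Ty = Bool.¬-not λ Ruy →
      let e = trans (cong (R u) (inverseʳ σ)) Ruy in
      true≢false (reached u Su e) (trans (sym (Bool.not-involutive _)) (cong not Ty))
      where
      reached : ∀ u → insert r U u ≡ true → R u (σ ⟨$⟩ʳ (σ ⟨$⟩ˡ y)) ≡ true → U (σ ⟨$⟩ˡ y) ≡ true
      reached u Su e with insert-elim r U u Su
      ... | inj₁ refl = start _ e
      ... | inj₂ Uu = closed u _ Uu e
    T-count : ∣ T ∣ ≡ ∣ not ∘ U ∣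
    T-count = trans (sym (∣∣-permute T σ)) (∣∣-cong (λ v → cong (not ∘ U) (inverseˡ σ)))
    big : n < ∣ insert r U ∣ + ∣ T ∣
    big = ≤-reflexive (sym (trans (cong₂ _+_ (∣∣-insert r U Ur) T-count) (cong suc (∣∣-total U))))

  -- Vertices are made good one at a time in index order, starting from the identity; `keep`
  -- protects the earlier ones.
  hall : (∃ λ σ → ∀ v → Good σ v) ⊎ Violator
  hall with go n ≤-refl
    where
    go : ∀ k → k ≤ n → (∃ λ σ → ∀ v → toℕ v < k → Good σ v) ⊎ Violator
    go zero _ = inj₁ (idₚ , λ _ ())
    go (suc k) k<n with go k (≤-trans (n≤1+n k) k<n)
    ... | inj₂ viol = inj₂ viol
    ... | inj₁ (σ , good) with R (fromℕ< k<n) (σ ⟨$⟩ʳ fromℕ< k<n) in eq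
    ...   | true = inj₁ (σ , good′)
      where
      good′ : ∀ v → toℕ v < suc k → Good σ v
      good′ v (s≤s v≤k) with m≤n⇒m<n∨m≡n v≤k
      ... | inj₁ v<k = good v v<k
      ... | inj₂ v≡k = subst (Good σ) (toℕ-injective (trans (toℕ-fromℕ< k<n) (sym v≡k))) eq
    ...   | false with improve-or-violate σ (fromℕ< k<n) eq
    ...     | inj₂ viol = inj₂ viol
    ...     | inj₁ (σ′ , keep , good-r) = inj₁ (σ′ , good′)
      where
      good′ : ∀ v → toℕ v < suc k → Good σ′ v
      good′ v (s≤s v≤k) with m≤n⇒m<n∨m≡n v≤k
      ... | inj₁ v<k = keep v (good v v<k)
      ... | inj₂ v≡k = subst (Good σ′) (toℕ-injective (trans (toℕ-fromℕ< k<n) (sym v≡k))) good-r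
  ... | inj₁ (σ , good) = inj₁ (σ , λ v → good v (toℕ<n v))
  ... | inj₂ viol = inj₂ viol

-- Orbits of an injective map and Hamiltonian cycles

Orbit : (Fin n → Fin n) → Fin n → Fin n → Set
Orbit f = Star (λ u v → f u ≡ v)

module Orbits {n : ℕ} (f : Fin n → Fin n) (f-injective : ∀ {u v} → f u ≡ f v → u ≡ v) where

  iterate-suc : ∀ x k → iterate f x (suc k) ≡ f (iterate f x k)
  iterate-suc x zero = refl
  iterate-suc x (suc k) = iterate-suc (f x) k

  iterate-+ : ∀ x k j → iterate f x (k + j) ≡ iterate f (iterate f x k) j
  iterate-+ x zero j = refl
  iterate-+ x (suc k) j = iterate-+ (f x) k j

  iterate-injective : ∀ k {x y} → iterate f x k ≡ iterate f y k → x ≡ y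
  iterate-injective zero eq = eq
  iterate-injective (suc k) eq = f-injective (iterate-injective k eq)

  iterate-orbit : ∀ x k → Orbit f x (iterate f x k)
  iterate-orbit x zero = ε
  iterate-orbit x (suc k) = refl ◅ iterate-orbit (f x) k

  -- Injectivity cancels the first `i` steps, leaving the period `j - i`, written `suc d` to be
  -- visibly positive.
  collision⇒period : ∀ x {i j} → i < j → iterate f x i ≡ iterate f x j →
                     ∃ λ d → suc d ≤ j × iterate f x (suc d) ≡ x
  collision⇒period x {i} i<j eq with m≤n⇒∃[o]m+o≡n i<j
  ... | d , refl = d , s≤s (m≤n+m d i) ,
    iterate-injective i (sym (trans eq (trans (cong (iterate f x) (cong suc (+-comm i d))) (iterate-+ x (suc d) i))))

  periodic : ∀ x → ∃ λ d → suc d ≤ n × iterate f x (suc d) ≡ x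
  periodic x with pigeonhole (n<1+n n) (λ i → iterate f x (toℕ i))
  ... | i , j , i<j , eq with collision⇒period x i<j eq
  ...   | d , d<j , period = d , ≤-trans d<j (≤-pred (toℕ<n j)) , period

  return : ∀ x → Orbit f (f x) x
  return x with periodic x
  ... | d , _ , period = subst (Orbit f (f x)) period (iterate-orbit (f x) d)

  preimage : ∀ v → ∃ λ u → f u ≡ v
  preimage v with periodic v
  ... | d , _ , period = iterate f v d , trans (sym (iterate-suc v d)) period

  -- The path is followed while an index below the period is maintained, wrapping to 0 after `d`.
  -- The general start `z` at index `i` is what the induction needs.
  covers : ∀ {x v z d i} → iterate f x (suc d) ≡ x → i < suc d → iterate f x i ≡ z → Orbit f z v →
           ∃ λ j → j < suc d × iterate f x j ≡ v
  covers period i<p at-i ε = _ , i<p , at-i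
  covers {x} {i = i} period (s≤s i≤d) refl (refl ◅ path) with m≤n⇒m<n∨m≡n i≤d
  ... | inj₁ i<d = covers period (s≤s i<d) (iterate-suc x i) path
  ... | inj₂ refl = covers period (s≤s z≤n) (trans (sym period) (iterate-suc x i)) path

  -- All vertices occur among the first `suc d` iterates, so sending each to an index is injective.
  spanning⇒≤period : ∀ {x d} → (∀ v → Orbit f x v) → iterate f x (suc d) ≡ x → n ≤ suc d
  spanning⇒≤period {x} {d} spans period = injective⇒≤ {f = index} index-injective
    where
    at : ∀ v → ∃ λ j → j < suc d × iterate f x j ≡ v
    at v = covers {d = d} {i = 0} period (s≤s z≤n) refl (spans v)
    index : Fin n → Fin (suc d)
    index v = fromℕ< (proj₁ (proj₂ (at v)))
    index-at : ∀ v → iterate f x (toℕ (index v)) ≡ v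
    index-at v = trans (cong (iterate f x) (toℕ-fromℕ< (proj₁ (proj₂ (at v))))) (proj₂ (proj₂ (at v)))
    index-injective : ∀ {u v} → index u ≡ index v → u ≡ v
    index-injective {u} {v} eq = trans (sym (index-at u)) (trans (cong (iterate f x ∘ toℕ) eq) (index-at v))

  -- Uniqueness and membership are proved for `tabulate`, the arc condition for the recursively
  -- built list.
  tabulate-iterate : ∀ x m → tabulate {n = m} (λ i → iterate f x (toℕ i)) ≡ List.iterate f x m
  tabulate-iterate x zero = refl
  tabulate-iterate x (suc m) = cong (x ∷_) (tabulate-iterate (f x) m)

  module _ (D : Digraph n) (arcs : ∀ v → arc D v (f v) ≡ true) where

    iterate-arcPath : ∀ x d {z} → iterate f x (suc d) ≡ z → ArcPath D (x ∷ List.iterate f (f x) d ++ z ∷ [])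
    iterate-arcPath x zero refl = arcs x , _
    iterate-arcPath x (suc d) eq = arcs x , iterate-arcPath (f x) d eq

    spanning⇒hamiltonian : ∀ x → (∀ v → Orbit f x v) → Hamiltonian D
    spanning⇒hamiltonian x spans with periodic x
    ... | d , d<n , period =
      x , List.iterate f (f x) d
      , subst Unique (tabulate-iterate x (suc d)) (Unique.tabulate⁺ distinct)
      , (λ v → subst (v ∈_) (tabulate-iterate x (suc d)) (occurs v))
      , iterate-arcPath x d period
      where
      -- A collision would give a period at most `j`, below `suc d ≤ n`, whereas a spanning orbit
      -- has no period below `n`.
      no-collision : ∀ {i j : Fin (suc d)} → toℕ i < toℕ j → iterate f x (toℕ i) ≢ iterate f x (toℕ j)
      no-collision {i} {j} i<j eq with collision⇒period x i<j eq
      ... | d′ , d′<j , period′ =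
        <⇒≱ (≤-trans (toℕ<n j) d<n) (≤-trans (spanning⇒≤period spans period′) d′<j)
      distinct : ∀ {i j : Fin (suc d)} → iterate f x (toℕ i) ≡ iterate f x (toℕ j) → i ≡ j
      distinct {i} {j} eq with <-cmp (toℕ i) (toℕ j)
      ... | tri< i<j _ _ = ⊥-elim (no-collision i<j eq)
      ... | tri≈ _ i≡j _ = toℕ-injective i≡j
      ... | tri> _ _ j<i = ⊥-elim (no-collision j<i (sym eq))
      occurs : ∀ v → v ∈ tabulate {n = suc d} (λ i → iterate f x (toℕ i))
      occurs v with covers {d = d} {i = 0} period (s≤s z≤n) refl (spans v)
      ... | j , j<p , refl = subst (λ k → iterate f x k ∈ tabulate {n = suc d} (λ i → iterate f x (toℕ i)))
                                   (toℕ-fromℕ< j<p) (∈-tabulate⁺ {f = λ i → iterate f x (toℕ i)} (fromℕ< j<p))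

perm-injective : (σ : Permutation′ n) → ∀ {u v} → σ ⟨$⟩ʳ u ≡ σ ⟨$⟩ʳ v → u ≡ v
perm-injective σ eq = trans (sym (inverseˡ σ)) (trans (cong (σ ⟨$⟩ˡ_) eq) (inverseˡ σ))

-- Composing with a transposition joins the two orbits it meets.
module Merge {n : ℕ} (σ : Permutation′ n) (B : Fin n → Bool)
             (invariant : ∀ v → B (σ ⟨$⟩ʳ v) ≡ B v)
             {x y : Fin n} (x∈B : B x ≡ true) (y∉B : B y ≡ false) where

  σ′ : Permutation′ n
  σ′ = swap x y σ

  open Orbits (σ ⟨$⟩ʳ_) (perm-injective σ) using (return)

  fixed : ∀ {v} → v ≢ x → v ≢ y → σ′ ⟨$⟩ʳ v ≡ σ ⟨$⟩ʳ v
  fixed = swap-other x y σ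

  -- The path is cut at its first visit to `x`; up to there it stays in `B`, away from `y`, where
  -- both permutations agree.
  to-x : ∀ {w} → B w ≡ true → Orbit (σ ⟨$⟩ʳ_) w x → Orbit (σ′ ⟨$⟩ʳ_) w x
  to-x w∈B ε = ε
  to-x {w} w∈B (refl ◅ path) with w ≟ x
  ... | yes refl = ε
  ... | no w≢x = fixed w≢x (λ { refl → true≢false w∈B y∉B }) ◅ to-x (trans (invariant w) w∈B) path

  to-y : ∀ {w} → B w ≡ false → Orbit (σ ⟨$⟩ʳ_) w y → Orbit (σ′ ⟨$⟩ʳ_) w y
  to-y w∉B ε = ε
  to-y {w} w∉B (refl ◅ path) with w ≟ y
  ... | yes refl = ε
  ... | no w≢y = fixed (λ { refl → true≢false x∈B w∉B }) w≢y ◅ to-y (trans (invariant w) w∉B) path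

  x⇝y : Orbit (σ′ ⟨$⟩ʳ_) x y
  x⇝y = swap-fst x y σ ◅ to-y (trans (invariant y) y∉B) (return y)

  y⇝x : Orbit (σ′ ⟨$⟩ʳ_) y x
  y⇝x = swap-snd x y σ ◅ to-x (trans (invariant x) x∈B) (return x)

  -- The old step out of `x` becomes the detour from `x` to `y` followed by the new step out of `y`,
  -- and symmetrically.
  simulate : ∀ {u v} → Orbit (σ ⟨$⟩ʳ_) u v → Orbit (σ′ ⟨$⟩ʳ_) u v
  simulate ε = ε
  simulate {u} (refl ◅ path) with u ≟ x | u ≟ y
  ... | yes refl | _ = x⇝y ◅◅ (swap-snd x y σ ◅ simulate path)
  ... | no _ | yes refl = y⇝x ◅◅ (swap-fst x y σ ◅ simulate path)
  ... | no u≢x | no u≢y = fixed u≢x u≢y ◅ simulate path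

-- Disjoint sets and sums over a subset

not-true : ∀ {b} → not b ≡ true → b ≡ false
not-true {false} _ = refl

∣∣-disjoint : {P Q R : Fin n → Bool} → (∀ v → P v ≡ true → R v ≡ true) → (∀ v → Q v ≡ true → R v ≡ true) →
              (∀ v → P v ≡ true → Q v ≡ true → ⊥) → ∣ P ∣ + ∣ Q ∣ ≤ ∣ R ∣
∣∣-disjoint {P = P} {Q} {R} P⊆R Q⊆R disjoint = begin
  ∣ P ∣ + ∣ Q ∣                              ≡⟨ cong₂ _+_ (∣∣≡∑ P) (∣∣≡∑ Q) ⟩
  ∑ (λ v → ⟦ P v ⟧) + ∑ (λ v → ⟦ Q v ⟧)      ≡⟨ ∑-+ _ _ ⟨
  ∑ (λ v → ⟦ P v ⟧ + ⟦ Q v ⟧)                ≤⟨ ∑-mono pointwise ⟩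
  ∑ (λ v → ⟦ R v ⟧)                          ≡⟨ ∣∣≡∑ R ⟨
  ∣ R ∣                                      ∎
  where
  open ≤-Reasoning
  pointwise : ∀ v → ⟦ P v ⟧ + ⟦ Q v ⟧ ≤ ⟦ R v ⟧
  pointwise v with P v in Pv | Q v in Qv
  ... | true | true = ⊥-elim (disjoint v Pv Qv)
  ... | true | false rewrite P⊆R v Pv = ≤-refl
  ... | false | true rewrite Q⊆R v Qv = ≤-refl
  ... | false | false = z≤n

∑[_] : (Fin n → Bool) → (Fin n → ℕ) → ℕ
∑[ P ] f = ∑ (λ v → ⟦ P v ⟧ * f v)

∑[]-mono : (P : Fin n → Bool) {f g : Fin n → ℕ} → (∀ v → P v ≡ true → f v ≤ g v) → ∑[ P ] f ≤ ∑[ P ] g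
∑[]-mono P {f} {g} h = ∑-mono pointwise
  where
  pointwise : ∀ v → ⟦ P v ⟧ * f v ≤ ⟦ P v ⟧ * g v
  pointwise v with P v in Pv
  ... | true = *-monoʳ-≤ 1 (h v Pv)
  ... | false = z≤n

∑[]-+ : (P : Fin n → Bool) (f g : Fin n → ℕ) → ∑[ P ] (λ v → f v + g v) ≡ ∑[ P ] f + ∑[ P ] g
∑[]-+ P f g = trans (∑-cong (λ v → *-distribˡ-+ ⟦ P v ⟧ (f v) (g v))) (∑-+ _ _)

∑[]-const : (P : Fin n → Bool) (k : ℕ) → ∑[ P ] (λ _ → k) ≡ ∣ P ∣ * k
∑[]-const P k = trans (∑-*ʳ _ k) (cong (_* k) (sym (∣∣≡∑ P)))

∑[]-≥ : (P : Fin n → Bool) {f : Fin n → ℕ} (k : ℕ) → (∀ v → P v ≡ true → k ≤ f v) → ∣ P ∣ * k ≤ ∑[ P ] f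
∑[]-≥ P k h = ≤-trans (≤-reflexive (sym (∑[]-const P k))) (∑[]-mono P h)

∑[]-≤ : (P : Fin n → Bool) {f : Fin n → ℕ} (k : ℕ) → (∀ v → P v ≡ true → f v ≤ k) → ∑[ P ] f ≤ ∣ P ∣ * k
∑[]-≤ P k h = ≤-trans (∑[]-mono P h) (≤-reflexive (∑[]-const P k))

∑[]-*ˡ : (P : Fin n → Bool) (k : ℕ) (f : Fin n → ℕ) → ∑[ P ] (λ v → k * f v) ≡ k * ∑[ P ] f
∑[]-*ˡ P k f = trans (∑-cong (λ v → swap-factors ⟦ P v ⟧ k (f v))) (∑-*ˡ k _)
  where
  swap-factors : ∀ x y z → x * (y * z) ≡ y * (x * z)
  swap-factors = solve-∀

∑[]-split : (P Q : Fin n → Bool) (f : Fin n → ℕ) →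
            ∑[ P ] f ≡ ∑[ (λ v → P v ∧ Q v) ] f + ∑[ (λ v → P v ∧ not (Q v)) ] f
∑[]-split P Q f = trans (∑-cong (λ v → split (P v) (Q v) (f v))) (∑-+ _ _)
  where
  split : ∀ b c k → ⟦ b ⟧ * k ≡ ⟦ b ∧ c ⟧ * k + ⟦ b ∧ not c ⟧ * k
  split false c k = refl
  split true true k = sym (+-identityʳ (k + 0))
  split true false k = refl

∑[]-∣∧∣ : (P Q : Fin n → Bool) → ∑[ P ] (λ v → ⟦ Q v ⟧) ≡ ∣ (λ v → P v ∧ Q v) ∣
∑[]-∣∧∣ P Q = trans (∑-cong (λ v → sym (⟦⟧-∧ (P v) (Q v)))) (sym (∣∣≡∑ _))

∑[]-｛｝ : (P : Fin n → Bool) {x : Fin n} (k : ℕ) → P x ≡ true → ∑[ P ] (λ v → ⟦ ｛ x ｝ v ⟧ * k) ≡ k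
∑[]-｛｝ P {x} k Px = trans (∑-cong (λ v → swap-factors ⟦ P v ⟧ ⟦ ｛ x ｝ v ⟧ k))
  (trans (∑-｛｝ x (λ v → ⟦ P v ⟧ * k)) (trans (cong (λ b → ⟦ b ⟧ * k) Px) (+-identityʳ k)))
  where
  swap-factors : ∀ x y z → x * (y * z) ≡ y * (x * z)
  swap-factors = solve-∀

∑[]-member : (P : Fin n → Bool) {x : Fin n} (f : Fin n → ℕ) → P x ≡ true → f x ≤ ∑[ P ] f
∑[]-member P {x} f Px = ≤-trans (≤-reflexive (sym (∑-｛｝ x f))) (∑-mono pointwise)
  where
  pointwise : ∀ v → ⟦ ｛ x ｝ v ⟧ * f v ≤ ⟦ P v ⟧ * f v
  pointwise v with x ≟ v
  ... | yes refl rewrite Px = ≤-refl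
  ... | no _ = z≤n

does-true : {A : Set} (A? : Dec A) → does A? ≡ true → A
does-true (yes x) _ = x

does-false : {A : Set} (A? : Dec A) → does A? ≡ false → ¬ A
does-false (no ¬x) _ = ¬x

-- Arithmetic of the final contradictions

combination-absurd : ∀ {x₁ y₁ x₂ y₂ x₃ y₃ x₄ y₄} z → x₁ ≤ y₁ → x₂ ≤ y₂ → x₃ ≤ y₃ → x₄ ≤ y₄ → 1 ≤ z →
                     x₁ + (2 * x₂ + (4 * x₃ + x₄)) ≡ y₁ + (2 * y₂ + (4 * y₃ + y₄)) + z → ⊥
combination-absurd {y₁ = y₁} {y₂ = y₂} {y₃ = y₃} {y₄ = y₄} z h₁ h₂ h₃ h₄ 1≤z eq =
  <⇒≱ (≤-trans (m<m+n (y₁ + (2 * y₂ + (4 * y₃ + y₄))) 1≤z) (≤-reflexive (sym eq)))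
      (+-mono-≤ h₁ (+-mono-≤ (*-monoʳ-≤ 2 h₂) (+-mono-≤ (*-monoʳ-≤ 4 h₃) h₄)))

-- Here and below, `c` is the size of one side of S, `Δ` its degree sum, `E` the number of arcs
-- entering it from S, and `s` the slack in `2c ≤ a`. The multipliers 1, 2, 4 eliminate `Δ` and `E`;
-- in this case an excess `c + c * s` remains.
average-absurd : ∀ c s {a} Δ E → 1 ≤ c → c + c + s ≡ a → c * (3 * a + 1) ≤ 2 * Δ → E ≤ c * c →
                 Δ + c * c ≤ 2 * E + c * a → ⊥
average-absurd c s Δ E 1≤c refl Δ≥ E≤ deficient =
  combination-absurd (c + c * s) Δ≥ deficient E≤ (≤-refl {c}) (≤-trans 1≤c (m≤m+n c (c * s))) (eq c s Δ E)
  where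
  eq : ∀ c s Δ E →
       c * (3 * (c + c + s) + 1) + (2 * (Δ + c * c) + (4 * E + c)) ≡
       2 * Δ + (2 * (2 * E + c * (c + c + s)) + (4 * (c * c) + c)) + (c + c * s)
  eq = solve-∀

-- One light vertex lowers the bound on `2 * Δ` by `a - 1`, but the loss of `c` arcs in `E` counts
-- four times and outweighs this.
isolated-absurd : ∀ c s {a} Δ E → 1 ≤ c → c + c + s ≡ a → c * (3 * a + 1) + 1 ≤ 2 * Δ + 1 * a →
                  E + c * 1 ≤ c * c → Δ + c * c ≤ 2 * E + c * a → ⊥
isolated-absurd c s Δ E 1≤c refl Δ≥ E≤ deficient =
  combination-absurd (1 + 3 * c) Δ≥ deficient E≤ (*-monoʳ-≤ s 1≤c) (m≤m+n 1 (3 * c)) (eq c s Δ E)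
  where
  eq : ∀ c s Δ E →
       c * (3 * (c + c + s) + 1) + 1 + (2 * (Δ + c * c) + (4 * (E + c * 1) + s * 1)) ≡
       2 * Δ + 1 * (c + c + s) + (2 * (2 * E + c * (c + c + s)) + (4 * (c * c) + s * c)) + (1 + 3 * c)
  eq = solve-∀

-- With `p` light vertices the degree bound loses `p * (a - 1)`, while `E` is at most
-- `c * (1 + c - p)`. The products of `2 ≤ p` with `c + c` and of `p ≤ c` with `s` make the
-- combination linear.
many-absurd : ∀ c s {a} Δ E p → 2 ≤ p → p ≤ c → c + c + s ≡ a → c * (3 * a + 1) + p ≤ 2 * Δ + p * a →
              E + c * p ≤ c * (1 + c) → Δ + c * c ≤ 2 * E + c * a → ⊥
many-absurd c s Δ E p 2≤p p≤c refl Δ≥ E≤ deficient =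
  combination-absurd (p + c) Δ≥ deficient E≤ (+-mono-≤ (*-monoʳ-≤ (c + c) 2≤p) (*-monoʳ-≤ s p≤c))
    (≤-trans (≤-trans (n≤1+n 1) 2≤p) (m≤m+n p c)) (eq c s Δ E p)
  where
  eq : ∀ c s Δ E p →
       c * (3 * (c + c + s) + 1) + p + (2 * (Δ + c * c) + (4 * (E + c * p) + ((c + c) * 2 + s * p))) ≡
       2 * Δ + p * (c + c + s) + (2 * (2 * E + c * (c + c + s)) + (4 * (c * (1 + c)) + ((c + c) * p + s * c))) + (p + c)
  eq = solve-∀

-- Degrees in the bipartite digraph

module Bipartite {n : ℕ} (a : ℕ) (2≤a : 2 ≤ a) (D : Digraph n) (side : Fin n → Bool)
  (crossing : ∀ u v → arc D u v ≡ true → side u ≢ side v)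
  (∣side∣ : count side ≡ a) (∣not-side∣ : count (λ v → not (side v)) ≡ a)
  (pairs : ∀ u v → Dominated D u v → 3 * a + 1 ≤ deg D u + deg D v) where

  -- A Boolean index lets one argument serve both sides, `not b` being opposite to `b`.
  part : Bool → Fin n → Bool
  part true v = side v
  part false v = not (side v)

  ∣part∣ : ∀ b → ∣ part b ∣ ≡ a
  ∣part∣ true = trans (∣∣≡count _) ∣side∣
  ∣part∣ false = trans (∣∣≡count _) ∣not-side∣

  side-part : ∀ v → part (side v) v ≡ true
  side-part v with side v in eq
  ... | true = eq
  ... | false = cong not eq

  succ-part : ∀ b {u v} → arc D u v ≡ true → part b u ≡ true → part (not b) v ≡ true
  succ-part b {u} {v} e p with side u in su | side v in sv
  ... | true | true = ⊥-elim (crossing u v e (trans su (sym sv)))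
  ... | false | false = ⊥-elim (crossing u v e (trans su (sym sv)))
  succ-part true e p | true | false = cong not sv
  succ-part true e p | false | true = ⊥-elim (true≢false p su)
  succ-part false e p | false | true = sv
  succ-part false e p | true | false = ⊥-elim (true≢false p (cong not su))

  pred-part : ∀ b {u v} → arc D u v ≡ true → part b v ≡ true → part (not b) u ≡ true
  pred-part b {u} {v} e p with side u in su | side v in sv
  ... | true | true = ⊥-elim (crossing u v e (trans su (sym sv)))
  ... | false | false = ⊥-elim (crossing u v e (trans su (sym sv)))
  pred-part true e p | false | true = cong not su
  pred-part true e p | true | false = ⊥-elim (true≢false p sv)
  pred-part false e p | true | false = su
  pred-part false e p | false | true = ⊥-elim (true≢false p (cong not sv))

  out in⁻ d : Fin n → ℕ
  out v = ∣ (λ w → arc D v w) ∣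
  in⁻ v = ∣ (λ w → arc D w v) ∣
  d v = out v + in⁻ v

  pair-degrees : ∀ {u v w} → u ≢ v → arc D w u ≡ true → arc D w v ≡ true → 3 * a + 1 ≤ d u + d v
  pair-degrees {u} {v} {w} u≢v wu wv =
    ≤-trans (pairs u v (u≢v , w , wu , wv)) (≤-reflexive (sym (cong₂ _+_ (d≡deg u) (d≡deg v))))
    where
    d≡deg : ∀ v → d v ≡ deg D v
    d≡deg v = cong₂ _+_ (∣∣≡count _) (∣∣≡count _)

  out≤a : ∀ v → out v ≤ a
  out≤a v = ≤-trans (∣∣-mono (λ w e → succ-part (side v) e (side-part v))) (≤-reflexive (∣part∣ (not (side v))))

  in≤a : ∀ v → in⁻ v ≤ a
  in≤a v = ≤-trans (∣∣-mono (λ w e → pred-part (side v) e (side-part v))) (≤-reflexive (∣part∣ (not (side v))))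

  -- In- and outdegree are at most `a`, so degree `2 * a` forces outdegree `a`, the size of the
  -- opposite side.
  full-out : ∀ {b v w} → 2 * a ≤ d v → part b v ≡ true → part (not b) w ≡ true → arc D v w ≡ true
  full-out {b} {v} {w} 2a≤d pv pw =
    ∣∣-full (λ w e → succ-part b e pv) (≤-trans (≤-reflexive (∣part∣ (not b))) a≤out) w pw
    where
    a≤out : a ≤ out v
    a≤out = ≤-from 0 (≤-trans 2a≤d (+-monoʳ-≤ (out v) (in≤a v))) (eq a (out v))
      where
      eq : ∀ a o → a + (o + a) + 0 ≡ o + 2 * a
      eq = solve-∀

  full-in : ∀ {b v w} → 2 * a ≤ d v → part b v ≡ true → part (not b) w ≡ true → arc D w v ≡ true
  full-in {b} {v} {w} 2a≤d pv pw =
    ∣∣-full (λ w e → pred-part b e pv) (≤-trans (≤-reflexive (∣part∣ (not b))) a≤in) w pw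
    where
    a≤in : a ≤ in⁻ v
    a≤in = ≤-from 0 (≤-trans 2a≤d (+-monoˡ-≤ (in⁻ v) (out≤a v))) (eq a (in⁻ v))
      where
      eq : ∀ a o → a + (a + o) + 0 ≡ o + 2 * a
      eq = solve-∀

  -- Of the `3 * a + 1` required, `u` supplies at most `a + 1`, so `v` must have the maximal degree.
  full-partner : ∀ {u v w} → u ≢ v → arc D w u ≡ true → arc D w v ≡ true → d u ≤ a + 1 → 2 * a ≤ d v
  full-partner {u} {v} u≢v wu wv du≤ =
    ≤-from 0 (≤-trans (pair-degrees u≢v wu wv) (+-monoˡ-≤ (d v) du≤)) (eq a (d v))
    where
    eq : ∀ a x → 2 * a + (a + 1 + x) + 0 ≡ x + (3 * a + 1)
    eq = solve-∀

  other-in-part : ∀ b v → ∃ λ w → v ≢ w × part b w ≡ true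
  other-in-part b v = other-member (≤-trans 2≤a (≤-reflexive (sym (∣part∣ b)))) v

  co-part : ∀ b {x y z} → arc D x y ≡ true → arc D x z ≡ true → part b y ≡ true → part b z ≡ true
  co-part b xy xz py = subst (λ c → part c _ ≡ true) (Bool.not-involutive b) (succ-part (not b) xz (pred-part b xy py))

  -- Vertices in no dominated pair

  Paired : Fin n → Set
  Paired v = ∃ λ u → Dominated D v u

  paired? : ∀ v → Dec (Paired v)
  paired? v = any? λ u → ¬? (v ≟ u) ×-dec any? (λ w → (arc D w v Bool.≟ true) ×-dec (arc D w u Bool.≟ true))

  -- Such a y has outdegree 1, so a partner of y would have degree 2a and dominate a pair containing v.
  unpaired-pred : ∀ {v y} → ¬ Paired v → arc D y v ≡ true → ¬ Paired y
  unpaired-pred {v} {y} unpaired yv (z , y≢z , x , xy , xz)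
    with other-in-part (not (side y)) v
  ... | v₂ , v≢v₂ , pv₂ = unpaired (v₂ , v≢v₂ , z , arc-z (succ-part b yv (side-part y)) , arc-z pv₂)
    where
    b = side y
    only : ∀ w → arc D y w ≡ true → v ≡ w
    only w yw with v ≟ w
    ... | yes eq = eq
    ... | no v≢w = ⊥-elim (unpaired (w , v≢w , y , yv , yw))
    out≤1 : out y ≤ 1
    out≤1 = ∣∣-≤1 (λ u w yu yw → trans (sym (only u yu)) (only w yw))
    full : 2 * a ≤ d z
    full = full-partner y≢z xy xz (≤-trans (+-mono-≤ out≤1 (in≤a y)) (≤-reflexive (+-comm 1 a)))
    arc-z : ∀ {w} → part (not b) w ≡ true → arc D z w ≡ true
    arc-z pw = full-out {b = b} full (co-part b xy xz (side-part y)) pw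

  unpaired-reach : ∀ {u v} → Reach D u v → ¬ Paired v → ¬ Paired u
  unpaired-reach here unpaired = unpaired
  unpaired-reach (step e r) unpaired = unpaired-pred (unpaired-reach r unpaired) e

  -- Without dominated pairs all arcs out of a vertex agree, so every path follows `next`. For its
  -- injectivity, `prev` is injective, hence onto by finiteness, and `next` inverts it.
  unpaired⇒hamiltonian : StronglyConnected D → Fin n → (∀ v → ¬ Paired v) → Hamiltonian D
  unpaired⇒hamiltonian strong x unpaired =
    Orbits.spanning⇒hamiltonian next next-injective D arc-next x (λ v → follow (strong x v))
    where
    unique : ∀ {w u v} → arc D w u ≡ true → arc D w v ≡ true → u ≡ v
    unique {w} {u} {v} wu wv with u ≟ v
    ... | yes eq = eq
    ... | no u≢v = ⊥-elim (unpaired u (v , u≢v , w , wu , wv))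
    first : ∀ {u v} → u ≢ v → Reach D u v → ∃ λ w → arc D u w ≡ true
    first u≢v here = ⊥-elim (u≢v refl)
    first u≢v (step e _) = _ , e
    final : ∀ {u v} → u ≢ v → Reach D u v → ∃ λ w → arc D w v ≡ true
    final u≢v here = ⊥-elim (u≢v refl)
    final {v = v} u≢v (step {w = w} e r) with w ≟ v
    ... | yes refl = _ , e
    ... | no w≢v = final w≢v r
    has-succ : ∀ v → ∃ λ w → arc D v w ≡ true
    has-succ v with other-in-part true v
    ... | w , v≢w , _ = first v≢w (strong v w)
    has-pred : ∀ v → ∃ λ w → arc D w v ≡ true
    has-pred v with other-in-part true v
    ... | w , v≢w , _ = final (v≢w ∘ sym) (strong w v)
    next prev : Fin n → Fin n
    next v = proj₁ (has-succ v)
    prev v = proj₁ (has-pred v)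
    arc-next : ∀ v → arc D v (next v) ≡ true
    arc-next v = proj₂ (has-succ v)
    arc-prev : ∀ v → arc D (prev v) v ≡ true
    arc-prev v = proj₂ (has-pred v)
    prev-injective : ∀ {u v} → prev u ≡ prev v → u ≡ v
    prev-injective {u} {v} eq = unique (arc-prev u) (subst (λ w → arc D w v ≡ true) (sym eq) (arc-prev v))
    next-prev : ∀ v → next (prev v) ≡ v
    next-prev v = unique (arc-next (prev v)) (arc-prev v)
    prev-next : ∀ v → prev (next v) ≡ v
    prev-next v = from-preimage (Orbits.preimage prev prev-injective v)
      where
      from-preimage : ∃ (λ w → prev w ≡ v) → prev (next v) ≡ v
      from-preimage (w , prev-w) = trans (cong prev (trans (cong next (sym prev-w)) (next-prev w))) prev-w
    next-injective : ∀ {u v} → next u ≡ next v → u ≡ v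
    next-injective {u} {v} eq = trans (sym (prev-next u)) (trans (cong prev eq) (prev-next v))
    follow : ∀ {u v} → Reach D u v → Orbit next u v
    follow here = ε
    follow (step e r) = unique (arc-next _) e ◅ follow r

  -- Cycle factor when all vertices are paired

  module AllPaired (paired : ∀ v → Paired v) where

    -- The partner's degree is at most `2 * a`.
    a+1≤d : ∀ v → a + 1 ≤ d v
    a+1≤d v with paired v
    ... | u , v≢u , w , wv , wu =
      ≤-from 0 (≤-trans (pair-degrees v≢u wv wu) (+-monoʳ-≤ (d v) (+-mono-≤ (out≤a u) (in≤a u)))) (eq a (d v))
      where
      eq : ∀ a x → a + 1 + (x + (a + a)) + 0 ≡ x + (3 * a + 1)
      eq = solve-∀

    -- Double counting: each vertex has at most one out-neighbour in an independent set.
    independent-in : (Y Z : Fin n → Bool) →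
                     (∀ {u v w} → Y u ≡ true → Y v ≡ true → u ≢ v → arc D w u ≡ true → arc D w v ≡ true → ⊥) →
                     (∀ {w y} → Y y ≡ true → arc D w y ≡ true → Z w ≡ true) → ∑[ Y ] in⁻ ≤ ∣ Z ∣
    independent-in Y Z indep preds = begin
      ∑[ Y ] in⁻
        ≡⟨ ∑-cong (λ y → trans (cong (⟦ Y y ⟧ *_) (∣∣≡∑ _)) (sym (∑-*ˡ ⟦ Y y ⟧ _))) ⟩
      ∑ (λ y → ∑ (λ w → ⟦ Y y ⟧ * ⟦ arc D w y ⟧))            ≡⟨ ∑-swap _ ⟩
      ∑ (λ w → ∑[ Y ] (λ y → ⟦ arc D w y ⟧))                 ≡⟨ ∑-cong (λ w → ∑[]-∣∧∣ Y (arc D w)) ⟩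
      ∑ (λ w → ∣ (λ y → Y y ∧ arc D w y) ∣)                  ≤⟨ ∑-mono pointwise ⟩
      ∑ (λ w → ⟦ Z w ⟧)                                      ≡⟨ ∣∣≡∑ Z ⟨
      ∣ Z ∣                                                  ∎
      where
      open ≤-Reasoning
      pointwise : ∀ w → ∣ (λ y → Y y ∧ arc D w y) ∣ ≤ ⟦ Z w ⟧
      pointwise w with Z w in Zw
      ... | true = ∣∣-≤1 λ u v hu hv → case-≟ u v (∧-elim hu) (∧-elim hv)
        where
        case-≟ : ∀ u v → Y u ≡ true × arc D w u ≡ true → Y v ≡ true × arc D w v ≡ true → u ≡ v
        case-≟ u v (Yu , wu) (Yv , wv) with u ≟ v
        ... | yes eq = eq
        ... | no u≢v = ⊥-elim (indep Yu Yv u≢v wu wv)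
      ... | false = ≤-reflexive (∣∣-empty (λ y → Bool.¬-not (λ h →
                      true≢false (preds (proj₁ (∧-elim h)) (proj₂ (∧-elim {Y y} h))) Zw)))

    -- Two disjointness bounds on a large arc-free pair; one of the two sets is too large to contain a dominated pair.
    no-arc-free : ∀ b (X Y : Fin n → Bool) →
                  (∀ v → X v ≡ true → part b v ≡ true) → (∀ v → Y v ≡ true → part (not b) v ≡ true) →
                  (∀ {x y} → X x ≡ true → Y y ≡ true → arc D x y ≡ true → ⊥) → a < ∣ X ∣ + ∣ Y ∣ → ⊥
    no-arc-free b X Y X⊆ Y⊆ no-arc large with a ≤? 2 * ∣ X ∣
    ... | yes a≤2k = <⇒≱ large (≤-trans (+-monoʳ-≤ k t≤Z) k+Z≤a)
      where
      k = ∣ X ∣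
      t = ∣ Y ∣
      Z : Fin n → Bool
      -- All in-neighbours of `Y` lie here, since `X` sends no arc to `Y`.
      Z v = part b v ∧ not (X v)
      k+Z≤a : k + ∣ Z ∣ ≤ a
      k+Z≤a = ≤-trans (∣∣-disjoint X⊆ (λ v h → proj₁ (∧-elim h))
                        (λ v Xv h → true≢false Xv (not-true (proj₂ (∧-elim {part b v} h)))))
                      (≤-reflexive (∣part∣ b))
      preds : ∀ {w y} → Y y ≡ true → arc D w y ≡ true → Z w ≡ true
      preds {w} {y} Yy wy = ∧-intro (subst (λ c → part c w ≡ true) (Bool.not-involutive b) (pred-part (not b) wy (Y⊆ y Yy)))
                              (cong not (Bool.¬-not (λ Xw → no-arc Xw Yy wy)))
      in+k≤a : ∀ {y} → Y y ≡ true → k + in⁻ y ≤ a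
      in+k≤a Yy = ≤-trans (+-monoʳ-≤ k (∣∣-mono (λ w wy → preds Yy wy))) k+Z≤a
      -- Degrees in `Y` are at most `2a - k`, so two of them sum to at most `4a - 2k ≤ 3a`.
      indep : ∀ {u v w} → Y u ≡ true → Y v ≡ true → u ≢ v → arc D w u ≡ true → arc D w v ≡ true → ⊥
      indep {u} {v} Yu Yv u≢v wu wv = ≤-absurd 0 (eq a k (out u) (out v) (in⁻ u) (in⁻ v))
        (+-mono-≤ (pair-degrees u≢v wu wv)
          (+-mono-≤ a≤2k (+-mono-≤ (+-mono-≤ (out≤a u) (out≤a v)) (+-mono-≤ (in+k≤a Yu) (in+k≤a Yv)))))
        where
        eq : ∀ a k ou ov iu iv →
             3 * a + 1 + (a + (ou + ov + (k + iu + (k + iv)))) ≡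
             suc (ou + iu + (ov + iv) + (2 * k + (a + a + (a + a))) + 0)
        eq = solve-∀
      t≤Z : t ≤ ∣ Z ∣
      t≤Z = ≤-trans (≤-reflexive (sym (*-identityʳ t)))
              (≤-trans (∑[]-≥ Y 1 (λ y _ → 1≤in y)) (independent-in Y Z indep preds))
        where
        1≤in : ∀ y → 1 ≤ in⁻ y
        1≤in y = ≤-from 0 (≤-trans (a+1≤d y) (+-monoˡ-≤ (in⁻ y) (out≤a y))) (eq a (in⁻ y))
          where
          eq : ∀ a i → 1 + (a + i) + 0 ≡ i + (a + 1)
          eq = solve-∀
    ... | no a≰2k = finish k refl large k*[t+1]≤a
      where
      k = ∣ X ∣
      t = ∣ Y ∣
      out+t≤a : ∀ {x} → X x ≡ true → out x + t ≤ a
      out+t≤a Xx = ≤-trans (∣∣-disjoint (λ w e → succ-part b e (X⊆ _ Xx)) Y⊆ (λ w e Yw → no-arc Xx Yw e))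
                           (≤-reflexive (∣part∣ (not b)))
      -- Outdegrees in `X` are at most `a - t < k`, so two degrees sum to less than `2a + 2k < 3a`.
      indep : ∀ {u v w} → X u ≡ true → X v ≡ true → u ≢ v → arc D w u ≡ true → arc D w v ≡ true → ⊥
      indep {u} {v} Xu Xv u≢v wu wv = ≤-absurd 3 (eq a k t (out u) (out v) (in⁻ u) (in⁻ v))
        (+-mono-≤ (pair-degrees u≢v wu wv)
          (+-mono-≤ (≰⇒> a≰2k) (+-mono-≤ (+-mono-≤ large large)
            (+-mono-≤ (+-mono-≤ (in≤a u) (in≤a v)) (+-mono-≤ (out+t≤a Xu) (out+t≤a Xv))))))
        where
        eq : ∀ a k t ou ov iu iv →
             3 * a + 1 + (suc (2 * k) + (suc a + suc a + (iu + iv + (ou + t + (ov + t))))) ≡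
             suc (ou + iu + (ov + iv) + (a + (k + t + (k + t) + (a + a + (a + a)))) + 3)
        eq = solve-∀
      -- Degree at least `a + 1` with outdegree at most `a - t` leaves this for the indegree.
      t+1≤in : ∀ x → X x ≡ true → suc t ≤ in⁻ x
      t+1≤in x Xx = ≤-from 0 (+-mono-≤ (a+1≤d x) (out+t≤a Xx)) (eq a t (out x) (in⁻ x))
        where
        eq : ∀ a t o i → suc t + (o + i + a) + 0 ≡ i + (a + 1 + (o + t))
        eq = solve-∀
      k*[t+1]≤a : k * suc t ≤ a
      k*[t+1]≤a = ≤-trans (∑[]-≥ X (suc t) t+1≤in) (≤-trans (independent-in X (part (not b)) indep
        (λ Xx e → pred-part b e (X⊆ _ Xx))) (≤-reflexive (∣part∣ (not b))))
      -- For `k = 0` the set `Y` alone would exceed its side; otherwise `k * (t + 1) ≥ k + t > a`.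
      finish : ∀ k → k ≡ ∣ X ∣ → a < ∣ X ∣ + t → ∣ X ∣ * suc t ≤ a → ⊥
      finish zero eq lt le = <⇒≱ (subst (λ k → a < k + t) (sym eq) lt)
        (≤-trans (∣∣-mono Y⊆) (≤-reflexive (∣part∣ (not b))))
      finish (suc k) eq lt le = ≤-absurd (k * t) (identity a k t)
        (+-mono-≤ (subst (λ k → a < k + t) (sym eq) lt) (subst (λ k → k * suc t ≤ a) (sym eq) le))
        where
        identity : ∀ a k t → suc a + suc k * suc t ≡ suc (suc k + t + a + k * t)
        identity = solve-∀

    -- As `n = 2a`, splitting `S` and `T` by side leaves one of the two opposite-side pairs with
    -- more than `a` vertices.
    no-violator : ¬ Hall.Violator (arc D)
    no-violator (S , T , no-arc , large) with a <? ∣ (λ v → S v ∧ side v) ∣ + ∣ (λ v → T v ∧ not (side v)) ∣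
    ... | yes lt = no-arc-free true _ _ (λ v h → proj₂ (∧-elim {S v} h)) (λ v h → proj₂ (∧-elim {T v} h))
                     (λ {x} {y} hx hy e → true≢false e (no-arc x y (proj₁ (∧-elim hx)) (proj₁ (∧-elim hy)))) lt
    ... | no ≮ = no-arc-free false _ _ (λ v h → proj₂ (∧-elim {S v} h)) (λ v h → proj₂ (∧-elim {T v} h))
                     (λ {x} {y} hx hy e → true≢false e (no-arc x y (proj₁ (∧-elim hx)) (proj₁ (∧-elim hy)))) lt
      where
      s₁ = ∣ (λ v → S v ∧ side v) ∣
      s₂ = ∣ (λ v → S v ∧ not (side v)) ∣
      t₁ = ∣ (λ v → T v ∧ side v) ∣
      t₂ = ∣ (λ v → T v ∧ not (side v)) ∣
      n≡2a : a + a ≡ n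
      n≡2a = trans (cong₂ _+_ (sym (∣part∣ true)) (sym (∣part∣ false))) (∣∣-total side)
      lt : a < s₂ + t₁
      lt = ≤-from 0 (+-mono-≤ (subst₂ _<_ (sym n≡2a) (cong₂ _+_ (∣∣-split S side) (∣∣-split T side)) large) (≮⇒≥ ≮))
             (eq a s₁ s₂ t₁ t₂)
        where
        eq : ∀ a s₁ s₂ t₁ t₂ → suc a + (s₁ + s₂ + (t₁ + t₂) + a) + 0 ≡ s₂ + t₁ + (suc (a + a) + (s₁ + t₂))
        eq = solve-∀

    cycle-factor : ∃ λ (σ : Permutation′ n) → ∀ v → arc D v (σ ⟨$⟩ʳ v) ≡ true
    cycle-factor with Hall.hall (arc D)
    ... | inj₁ factor = factor
    ... | inj₂ violator = ⊥-elim (no-violator violator)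

    -- Counting arcs at an invariant set that admits no exchange

    module Count
      (σ : Permutation′ n) (arcs : ∀ v → arc D v (σ ⟨$⟩ʳ v) ≡ true)
      (S : Fin n → Bool) (invariant : ∀ v → S (σ ⟨$⟩ʳ v) ≡ S v)
      (no-merge : ∀ {u w} → S u ≡ true → S w ≡ false → arc D u (σ ⟨$⟩ʳ w) ≡ true → arc D w (σ ⟨$⟩ʳ u) ≡ true → ⊥)
      where

      S∩ : Bool → Fin n → Bool
      S∩ b v = S v ∧ part b v

      c : ℕ
      c = ∣ S∩ true ∣

      shift-part : ∀ b v → part b (σ ⟨$⟩ʳ v) ≡ part (not b) v
      shift-part b v with part (not b) v in eq
      ... | true = subst (λ b′ → part b′ (σ ⟨$⟩ʳ v) ≡ true) (Bool.not-involutive b) (succ-part (not b) (arcs v) eq)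
      ... | false = Bool.¬-not (λ p → true≢false (pred-part b (arcs v) p) eq)

      -- Arcs change sides, so `σ` maps `S∩ false` bijectively onto `S∩ true`.
      ∣S∩∣ : ∀ b → ∣ S∩ b ∣ ≡ c
      ∣S∩∣ true = refl
      ∣S∩∣ false = trans (∣∣-cong (λ v → sym (cong₂ _∧_ (invariant v) (shift-part true v)))) (∣∣-permute (S∩ true) σ)

      ∣S∣ : ∣ S ∣ ≡ c + c
      ∣S∣ = trans (∣∣-split S side) (cong (c +_) (∣S∩∣ false))

      out-in in-in : Fin n → ℕ
      out-in v = ∣ (λ w → arc D v w ∧ S w) ∣
      in-in v = ∣ (λ w → arc D w v ∧ S w) ∣

      -- For w outside S at most one of the arcs v → σ w and w → σ v is present.
      local-bound : ∀ v → S v ≡ true → out v + in⁻ (σ ⟨$⟩ʳ v) + c ≤ out-in v + in-in (σ ⟨$⟩ʳ v) + a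
      local-bound v Sv = ≤-from 0 exterior
        (trans (cong (λ k → k + a + 0) (cong (_+ c) (cong₂ _+_ (∣∣-split (arc D v) S) (∣∣-split (λ w → arc D w σv) S))))
          (eq (out-in v) (in-in σv) _ _ c a))
        where
        σv = σ ⟨$⟩ʳ v
        b = side v
        out-ex in-ex outside : Fin n → Bool
        out-ex w = arc D v w ∧ not (S w)
        in-ex w = arc D w σv ∧ not (S w)
        outside w = part b w ∧ not (S w)
        -- Shifted back by `σ`, the out-neighbours lie on the side of `v`, like the in-neighbours of
        -- `σ v`, and a common `w` would allow an exchange.
        out-ex⊆ : ∀ w → out-ex (σ ⟨$⟩ʳ w) ≡ true → outside w ≡ true
        out-ex⊆ w h with ∧-elim {arc D v (σ ⟨$⟩ʳ w)} h
        ... | e , ∉S = ∧-intro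
          (trans (sym (trans (shift-part (not b) w) (cong (λ b′ → part b′ w) (Bool.not-involutive b))))
                 (succ-part b e (side-part v)))
          (trans (cong not (sym (invariant w))) ∉S)
        in-ex⊆ : ∀ w → in-ex w ≡ true → outside w ≡ true
        in-ex⊆ w h with ∧-elim {arc D w σv} h
        ... | e , ∉S = ∧-intro (co-pred e) ∉S
          where
          co-pred : arc D w σv ≡ true → part b w ≡ true
          co-pred e = subst (λ b′ → part b′ w ≡ true) (Bool.not-involutive b)
                        (pred-part (not b) e (succ-part b (arcs v) (side-part v)))
        outside+c : ∣ outside ∣ + c ≡ a
        outside+c = trans (+-comm ∣ outside ∣ c) (trans (cong (_+ ∣ outside ∣)
          (trans (sym (∣S∩∣ b)) (∣∣-cong (λ w → Bool.∧-comm (S w) (part b w)))))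
          (trans (sym (∣∣-split (part b) S)) (∣part∣ b)))
        exterior : ∣ out-ex ∣ + ∣ in-ex ∣ + c ≤ a
        exterior = ≤-trans (+-monoˡ-≤ c (≤-trans (≤-reflexive (cong (_+ ∣ in-ex ∣) (sym (∣∣-permute out-ex σ))))
          (∣∣-disjoint out-ex⊆ in-ex⊆ (λ w h h′ → no-merge Sv (not-true (proj₂ (∧-elim {arc D w σv} h′)))
            (proj₁ (∧-elim h)) (proj₁ (∧-elim h′)))))) (≤-reflexive outside+c)
        eq : ∀ oi ii oe ie c a → oi + oe + (ii + ie) + c + a + 0 ≡ oi + ii + a + (oe + ie + c)
        eq = solve-∀

      ∑out-in≡∑in-in : ∑[ S ] out-in ≡ ∑[ S ] in-in
      ∑out-in≡∑in-in = begin
        ∑[ S ] out-in                                              ≡⟨ expand (arc D) ⟩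
        ∑ (λ v → ∑ (λ w → ⟦ S v ⟧ * ⟦ arc D v w ∧ S w ⟧))          ≡⟨ ∑-swap _ ⟩
        ∑ (λ w → ∑ (λ v → ⟦ S v ⟧ * ⟦ arc D v w ∧ S w ⟧))
          ≡⟨ ∑-cong (λ w → ∑-cong (λ v → rearrange (S v) (arc D v w) (S w))) ⟩
        ∑ (λ w → ∑ (λ v → ⟦ S w ⟧ * ⟦ arc D v w ∧ S v ⟧))          ≡⟨ expand (λ w v → arc D v w) ⟨
        ∑[ S ] in-in                                               ∎
        where
        open ≡-Reasoning
        expand : (R : Fin n → Fin n → Bool) →
                 ∑[ S ] (λ v → ∣ (λ w → R v w ∧ S w) ∣) ≡ ∑ (λ v → ∑ (λ w → ⟦ S v ⟧ * ⟦ R v w ∧ S w ⟧))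
        expand R = ∑-cong (λ v → trans (cong (⟦ S v ⟧ *_) (∣∣≡∑ _)) (sym (∑-*ˡ ⟦ S v ⟧ _)))
        rearrange : ∀ s r t → ⟦ s ⟧ * ⟦ r ∧ t ⟧ ≡ ⟦ t ⟧ * ⟦ r ∧ s ⟧
        rearrange true true true = refl
        rearrange true true false = refl
        rearrange true false true = refl
        rearrange true false false = refl
        rearrange false true true = refl
        rearrange false true false = refl
        rearrange false false true = refl
        rearrange false false false = refl

      ∑[S]-shift : (f : Fin n → ℕ) → ∑[ S ] (λ v → f (σ ⟨$⟩ʳ v)) ≡ ∑[ S ] f
      ∑[S]-shift f = trans (∑-cong (λ v → cong (λ s → ⟦ s ⟧ * f (σ ⟨$⟩ʳ v)) (sym (invariant v))))
                           (∑-permute (λ v → ⟦ S v ⟧ * f v) σ)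

      ∑[S]-parts : (f : Fin n → ℕ) → ∑[ S ] f ≡ ∑[ S∩ true ] f + ∑[ S∩ false ] f
      ∑[S]-parts = ∑[]-split S side

      -- The local bounds are summed over S with the indegree terms reindexed by `σ`; both interior
      -- sums count the arcs inside S.
      upper-bound : ∑[ S ] d + (c + c) * c ≤ ∑[ S ] in-in + ∑[ S ] in-in + (c + c) * a
      upper-bound = begin
        ∑[ S ] d + (c + c) * c
          ≡⟨ cong₂ _+_ (trans (∑[]-+ S out in⁻) (trans (cong (∑[ S ] out +_) (sym (∑[S]-shift in⁻))) (sym (∑[]-+ S out _))))
                       (trans (cong (_* c) (sym ∣S∣)) (sym (∑[]-const S c))) ⟩
        ∑[ S ] (λ v → out v + in⁻ (σ ⟨$⟩ʳ v)) + ∑[ S ] (λ _ → c)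
          ≡⟨ ∑[]-+ S _ _ ⟨
        ∑[ S ] (λ v → out v + in⁻ (σ ⟨$⟩ʳ v) + c)
          ≤⟨ ∑[]-mono S local-bound ⟩
        ∑[ S ] (λ v → out-in v + in-in (σ ⟨$⟩ʳ v) + a)
          ≡⟨ trans (∑[]-+ S _ _) (cong₂ _+_ (∑[]-+ S out-in _) (trans (∑[]-const S a) (cong (_* a) ∣S∣))) ⟩
        ∑[ S ] out-in + ∑[ S ] (λ v → in-in (σ ⟨$⟩ʳ v)) + (c + c) * a
          ≡⟨ cong (_+ (c + c) * a) (cong₂ _+_ ∑out-in≡∑in-in (∑[S]-shift in-in)) ⟩
        ∑[ S ] in-in + ∑[ S ] in-in + (c + c) * a ∎
        where open ≤-Reasoning

      in-in≤c : ∀ b {v} → part b v ≡ true → in-in v ≤ c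
      in-in≤c b {v} pv = ≤-trans (∣∣-mono {Q = S∩ (not b)}
                         (λ w h → ∧-intro (proj₂ (∧-elim {arc D w v} h)) (pred-part b (proj₁ (∧-elim h)) pv)))
                       (≤-reflexive (∣S∩∣ (not b)))

      -- Both degrees in a 2-cycle S are a + 1, which makes z and σ z below adjacent to everything.
      c≢1 : c ≢ 1
      c≢1 c≡1 with member {P = S∩ true} (≤-reflexive (sym c≡1))
      ... | x , x∈ = conclude
        where
        Sx : S x ≡ true
        Sx = proj₁ (∧-elim x∈)
        px : part true x ≡ true
        px = proj₂ (∧-elim {S x} x∈)
        y = σ ⟨$⟩ʳ x
        Sy : S y ≡ true
        Sy = trans (invariant x) Sx
        py : part false y ≡ true
        py = succ-part true (arcs x) px
        ∑d≤ : ∑[ S ] d ≤ 2 * a + 2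
        ∑d≤ = ≤-from 0 (≤-trans
                (subst (λ k → ∑[ S ] d + (k + k) * k ≤ ∑[ S ] in-in + ∑[ S ] in-in + (k + k) * a) c≡1 upper-bound)
                (+-monoˡ-≤ ((1 + 1) * a) (+-mono-≤ ∑in-in≤2 ∑in-in≤2))) (eq (∑[ S ] d) a)
          where
          -- S has two vertices, each with at most one in-neighbour inside S.
          ∑in-in≤2 : ∑[ S ] in-in ≤ 2
          ∑in-in≤2 = ≤-trans (∑[]-≤ S 1 (λ v _ → subst (in-in v ≤_) c≡1 (in-in≤c (side v) (side-part v))))
                             (≤-reflexive (trans (*-identityʳ _) (trans ∣S∣ (cong₂ _+_ c≡1 c≡1))))
          eq : ∀ s a → s + (2 + 2 + (1 + 1) * a) + 0 ≡ 2 * a + 2 + (s + (1 + 1) * 1)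
          eq = solve-∀
        part-≥ : ∀ b → a + 1 ≤ ∑[ S∩ b ] d
        part-≥ b = ≤-trans (≤-reflexive (sym (trans (cong (_* (a + 1)) (trans (∣S∩∣ b) c≡1)) (+-identityʳ (a + 1)))))
                           (∑[]-≥ (S∩ b) (a + 1) (λ v _ → a+1≤d v))
        part-≤ : ∀ {p q} → ∑[ S ] d ≡ p + q → a + 1 ≤ q → p ≤ a + 1
        part-≤ {p} {q} split q≥ = ≤-from 0 (+-mono-≤ (≤-trans (≤-reflexive (sym split)) ∑d≤) q≥) (eq a p q)
          where
          eq : ∀ a p q → p + (2 * a + 2 + q) + 0 ≡ a + 1 + (p + q + (a + 1))
          eq = solve-∀
        dx≤ : d x ≤ a + 1
        dx≤ = ≤-trans (∑[]-member (S∩ true) d x∈) (part-≤ (∑[S]-parts d) (part-≥ false))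
        dy≤ : d y ≤ a + 1
        dy≤ = ≤-trans (∑[]-member (S∩ false) d (∧-intro Sy py))
                      (part-≤ (trans (∑[S]-parts d) (+-comm (∑[ S∩ true ] d) _)) (part-≥ true))
        conclude : ⊥
        -- The partner `x′` of `x` has degree `2a`, so it dominates `y` and `z`. Then `z` has degree
        -- `2a`, so it dominates `x` and `σ z`, and `σ z` has degree `2a` as well. The arcs from `y`
        -- to `σ z` and from `z` to `σ y` form an exchange.
        conclude with paired x | other-in-part false y
        ... | x′ , x≢x′ , w , wx , wx′ | z , y≢z , pz =
          no-merge Sy z∉S (full-in {b = true} full-σz pσz py) (full-out {b = false} full-z pz (succ-part false (arcs y) py))
          where
          full-x′ : 2 * a ≤ d x′
          full-x′ = full-partner x≢x′ wx wx′ dx≤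
          px′ : part true x′ ≡ true
          px′ = co-part true wx wx′ px
          z∉S : S z ≡ false
          z∉S = Bool.¬-not (λ Sz → ≤-absurd 0 refl (subst (2 ≤_) (trans (∣S∩∣ false) c≡1)
                  (∣∣-≥2 {P = S∩ false} y≢z (∧-intro Sy py) (∧-intro Sz pz))))
          full-z : 2 * a ≤ d z
          full-z = full-partner y≢z (full-out {b = true} full-x′ px′ py) (full-out {b = true} full-x′ px′ pz) dy≤
          pσz : part true (σ ⟨$⟩ʳ z) ≡ true
          pσz = succ-part false (arcs z) pz
          full-σz : 2 * a ≤ d (σ ⟨$⟩ʳ z)
          full-σz = full-partner (λ eq → true≢false Sx (trans (cong S eq) (trans (invariant z) z∉S)))
                      (full-out {b = false} full-z pz px) (arcs z) dx≤

      -- Light vertices on one side of S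

      module OneSide (b : Bool) (2≤c : 2 ≤ c) (s : ℕ) (a≡ : c + c + s ≡ a) where

        X Y light L : Fin n → Bool
        X = S∩ b
        Y = S∩ (not b)
        light v = does (2 * d v ≤? 3 * a)
        L v = X v ∧ light v

        h : Fin n → ℕ
        h y = ∣ (λ x → X x ∧ arc D y x) ∣

        E Δ : ℕ
        E = ∑[ X ] in-in
        Δ = ∑[ X ] d

        light-true : ∀ {v} → light v ≡ true → 2 * d v ≤ 3 * a
        light-true {v} = does-true (2 * d v ≤? 3 * a)

        light-false : ∀ {v} → light v ≡ false → 3 * a + 1 ≤ 2 * d v
        light-false {v} l = ≤-trans (≤-reflexive (+-comm (3 * a) 1)) (≰⇒> (does-false (2 * d v ≤? 3 * a) l))

        L-true : ∀ {v} → L v ≡ true → X v ≡ true × 2 * d v ≤ 3 * a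
        L-true {v} Lv with ∧-elim {X v} Lv
        ... | Xv , l = Xv , light-true l

        not-L : ∀ {v} → X v ≡ true → L v ≡ false → 3 * a + 1 ≤ 2 * d v
        not-L {v} Xv Lv = light-false (trans (cong (_∧ light v) (sym Xv)) Lv)

        E≤∑h : E ≤ ∑[ Y ] h
        E≤∑h = begin
          ∑[ X ] in-in
            ≡⟨ ∑-cong (λ v → trans (cong (⟦ X v ⟧ *_) (∣∣≡∑ _)) (sym (∑-*ˡ ⟦ X v ⟧ _))) ⟩
          ∑ (λ x → ∑ (λ w → ⟦ X x ⟧ * ⟦ arc D w x ∧ S w ⟧))         ≤⟨ ∑-mono (λ x → ∑-mono (λ w → pointwise x w)) ⟩
          ∑ (λ x → ∑ (λ w → ⟦ Y w ⟧ * ⟦ X x ∧ arc D w x ⟧))         ≡⟨ ∑-swap _ ⟩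
          ∑ (λ w → ∑ (λ x → ⟦ Y w ⟧ * ⟦ X x ∧ arc D w x ⟧))
            ≡⟨ ∑-cong (λ w → trans (∑-*ˡ ⟦ Y w ⟧ _) (cong (⟦ Y w ⟧ *_) (sym (∣∣≡∑ _)))) ⟩
          ∑[ Y ] h                                                  ∎
          where
          open ≤-Reasoning
          pointwise : ∀ x w → ⟦ X x ⟧ * ⟦ arc D w x ∧ S w ⟧ ≤ ⟦ Y w ⟧ * ⟦ X x ∧ arc D w x ⟧
          pointwise x w with X x in Xx | arc D w x in wx | S w in Sw
          ... | false | _ | _ = z≤n
          ... | true | false | _ = z≤n
          ... | true | true | false = z≤n
          ... | true | true | true rewrite pred-part b wx (proj₂ (∧-elim {S x} Xx)) = ≤-refl

        -- Sums the bounds `h y ≤ m - k` over `Y`, with `k` moved across to avoid truncated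
        -- subtraction.
        E-bound : ∀ k m → (∀ y → Y y ≡ true → h y + k ≤ m) → E + c * k ≤ c * m
        E-bound k m bound = begin
          E + c * k                        ≤⟨ +-monoˡ-≤ (c * k) E≤∑h ⟩
          ∑[ Y ] h + c * k
            ≡⟨ cong (∑[ Y ] h +_) (trans (cong (_* k) (sym (∣S∩∣ (not b)))) (sym (∑[]-const Y k))) ⟩
          ∑[ Y ] h + ∑[ Y ] (λ _ → k)      ≡⟨ ∑[]-+ Y h (λ _ → k) ⟨
          ∑[ Y ] (λ y → h y + k)           ≤⟨ ∑[]-≤ Y m bound ⟩
          ∣ Y ∣ * m                        ≡⟨ cong (_* m) (∣S∩∣ (not b)) ⟩
          c * m                            ∎
          where open ≤-Reasoning

        E≤c² : E ≤ c * c
        E≤c² = ≤-trans (≤-reflexive (sym (trans (cong (E +_) (*-zeroʳ c)) (+-identityʳ E))))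
          (E-bound 0 c (λ y _ → ≤-trans (≤-reflexive (+-identityʳ (h y)))
            (≤-trans (∣∣-mono (λ v hv → proj₁ (∧-elim hv))) (≤-reflexive (∣S∩∣ b)))))

        -- Compares degrees with the average `(3a + 1) / 2`; `f` records surpluses and `g`
        -- shortfalls.
        Δ-bound : ∀ (f g : Fin n → ℕ) → (∀ v → X v ≡ true → 3 * a + 1 + f v ≤ 2 * d v + g v) →
                  c * (3 * a + 1) + ∑[ X ] f ≤ 2 * Δ + ∑[ X ] g
        Δ-bound f g bound = begin
          c * (3 * a + 1) + ∑[ X ] f
            ≡⟨ cong (_+ ∑[ X ] f) (trans (cong (_* (3 * a + 1)) (sym (∣S∩∣ b))) (sym (∑[]-const X _))) ⟩
          ∑[ X ] (λ _ → 3 * a + 1) + ∑[ X ] f            ≡⟨ ∑[]-+ X _ f ⟨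
          ∑[ X ] (λ v → 3 * a + 1 + f v)                 ≤⟨ ∑[]-mono X bound ⟩
          ∑[ X ] (λ v → 2 * d v + g v)                   ≡⟨ trans (∑[]-+ X _ g) (cong (_+ ∑[ X ] g) (∑[]-*ˡ X 2 d)) ⟩
          2 * Δ + ∑[ X ] g                               ∎
          where open ≤-Reasoning

        -- The share of one side in `upper-bound`, which is the sum of the two shares.
        Deficient : Set
        Deficient = Δ + c * c ≤ 2 * E + c * a

        not-deficient : ¬ Deficient
        not-deficient deficient = by-light ∣ L ∣ refl
          where
          -- With a partner in X, the light vertex is compensated by the partner's degree.
          compensated : ∀ {x x′ y} → L x ≡ true → X x′ ≡ true → x ≢ x′ → arc D y x ≡ true → arc D y x′ ≡ true →
                        (∀ v → L v ≡ true → x ≡ v) → c * (3 * a + 1) ≤ 2 * Δ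
          compensated {x} {x′} Lx Xx′ x≢x′ yx yx′ only with m≤n⇒∃[o]m+o≡n (proj₂ (L-true Lx))
          ... | k , 2dx+k≡3a = +-cancelʳ-≤ k₁ _ _ (≤-trans
                  (≤-reflexive (cong (c * (3 * a + 1) +_) (sym (∑[]-｛｝ X k₁ Xx′))))
                  (≤-trans (Δ-bound (λ v → ⟦ ｛ x′ ｝ v ⟧ * k₁) (λ v → ⟦ ｛ x ｝ v ⟧ * k₁) pointwise)
                           (≤-reflexive (cong (2 * Δ +_) (∑[]-｛｝ X k₁ (proj₁ (L-true Lx)))))))
            where
            -- The shortfall of `2 * d x` from `3 * a + 1`. The pair condition gives `x′` at least
            -- this surplus, so the two corrections cancel.
            k₁ = k + 1
            2dx+k₁ : 2 * d x + k₁ ≡ 3 * a + 1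
            2dx+k₁ = trans (sym (+-assoc (2 * d x) k 1)) (cong (_+ 1) 2dx+k≡3a)
            at-x′ : 3 * a + 1 + k₁ ≤ 2 * d x′
            at-x′ = ≤-from 0 (*-monoʳ-≤ 2 (pair-degrees x≢x′ yx yx′))
              (trans (eq₁ (3 * a + 1) k₁ (d x) (d x′))
                (trans (cong (λ m → 3 * a + 1 + (2 * d x′ + m)) 2dx+k₁) (eq₂ (3 * a + 1) (d x′))))
              where
              eq₁ : ∀ t k p q → t + k + 2 * (p + q) + 0 ≡ t + (2 * q + (2 * p + k))
              eq₁ = solve-∀
              eq₂ : ∀ t q → t + (2 * q + t) ≡ 2 * q + 2 * t
              eq₂ = solve-∀
            pointwise : ∀ v → X v ≡ true → 3 * a + 1 + ⟦ ｛ x′ ｝ v ⟧ * k₁ ≤ 2 * d v + ⟦ ｛ x ｝ v ⟧ * k₁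
            pointwise v Xv with x ≟ v | x′ ≟ v
            ... | yes refl | yes refl = ⊥-elim (x≢x′ refl)
            ... | yes refl | no _ = ≤-reflexive (trans (+-identityʳ (3 * a + 1)) (trans (sym 2dx+k₁)
                                      (cong (2 * d x +_) (sym (+-identityʳ k₁)))))
            ... | no _ | yes refl = ≤-trans (≤-reflexive (cong (3 * a + 1 +_) (+-identityʳ k₁))) (≤-trans at-x′ (m≤m+n _ 0))
            ... | no x≢v | no _ = +-monoˡ-≤ 0 (not-L Xv (Bool.¬-not (λ Lv → x≢v (only v Lv))))

          -- Since `2 * d v ≥ 2a + 2`, a light vertex falls short of `3a + 1` by at most `a - 1`.
          light-bound : c * (3 * a + 1) + ∣ L ∣ ≤ 2 * Δ + ∣ L ∣ * a
          light-bound = subst₂ (λ p q → c * (3 * a + 1) + p ≤ 2 * Δ + q) (∑[]-∣∧∣ X light)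
            (trans (∑-cong (λ v → sym (*-assoc ⟦ X v ⟧ ⟦ light v ⟧ a))) (trans (∑-*ʳ _ a) (cong (_* a) (∑[]-∣∧∣ X light))))
            (Δ-bound (λ v → ⟦ light v ⟧) (λ v → ⟦ light v ⟧ * a) pointwise)
            where
            pointwise : ∀ v → X v ≡ true → 3 * a + 1 + ⟦ light v ⟧ ≤ 2 * d v + ⟦ light v ⟧ * a
            pointwise v Xv with light v in lv
            ... | true = ≤-from 0 (*-monoʳ-≤ 2 (a+1≤d v)) (eq a (d v))
              where
              eq : ∀ a x → 3 * a + 1 + 1 + 2 * x + 0 ≡ 2 * x + 1 * a + 2 * (a + 1)
              eq = solve-∀
            ... | false = +-monoˡ-≤ 0 (light-false lv)

          -- Two light vertices have degree sum at most `3a`, too little for a dominated pair.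
          lights-dominated : ∀ y u v → L u ≡ true → L v ≡ true → arc D y u ≡ true → arc D y v ≡ true → u ≡ v
          lights-dominated y u v Lu Lv yu yv with u ≟ v
          ... | yes eq = eq
          ... | no u≢v = ⊥-elim (≤-absurd 1 (eq a (d u) (d v))
                  (+-mono-≤ (*-monoʳ-≤ 2 (pair-degrees u≢v yu yv)) (+-mono-≤ (proj₂ (L-true Lu)) (proj₂ (L-true Lv)))))
            where
            eq : ∀ a x y → 2 * (3 * a + 1) + (2 * x + 2 * y) ≡ suc (2 * (x + y) + (3 * a + 3 * a) + 1)
            eq = solve-∀

          -- At most one out-neighbour of `y` is light; the others in `X` are among its `c - ∣ L ∣`
          -- remaining vertices.
          h+∣L∣ : ∀ y → Y y ≡ true → h y + ∣ L ∣ ≤ 1 + c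
          h+∣L∣ y _ = begin
            h y + ∣ L ∣                       ≡⟨ cong (_+ ∣ L ∣) (∣∣-split (λ x → X x ∧ arc D y x) light) ⟩
            ∣ P ∣ + ∣ Q ∣ + ∣ L ∣             ≡⟨ +-assoc (∣ P ∣) (∣ Q ∣) (∣ L ∣) ⟩
            ∣ P ∣ + (∣ Q ∣ + ∣ L ∣)           ≤⟨ +-mono-≤ (∣∣-≤1 P-unique)
                                                 (≤-trans (∣∣-disjoint {R = X} (λ v q → proj₁ (∧-elim (proj₁ (∧-elim q))))
                                                   (λ v l → proj₁ (∧-elim l))
                                                   (λ v q l → true≢false (proj₂ (∧-elim {X v} l)) (not-true (proj₂ (∧-elim {X v ∧ arc D y v} q)))))
                                                   (≤-reflexive (∣S∩∣ b))) ⟩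
            1 + c                             ∎
            where
            open ≤-Reasoning
            P Q : Fin n → Bool
            P x = (X x ∧ arc D y x) ∧ light x
            Q x = (X x ∧ arc D y x) ∧ not (light x)
            P-unique : ∀ u v → P u ≡ true → P v ≡ true → u ≡ v
            P-unique u v Pu Pv with ∧-elim {X u ∧ arc D y u} Pu | ∧-elim {X v ∧ arc D y v} Pv
            ... | Xyu , lu | Xyv , lv = lights-dominated y u v
                                          (∧-intro (proj₁ (∧-elim Xyu)) lu) (∧-intro (proj₁ (∧-elim Xyv)) lv)
                                          (proj₂ (∧-elim {X u} Xyu)) (proj₂ (∧-elim {X v} Xyv))

          -- If `y` dominates `x`, it dominates nothing else in `X`, and `1 + 1 ≤ c`. Otherwise it
          -- misses `x`.
          isolated : ∀ {x} → X x ≡ true →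
                     (∀ {x′ y} → X x′ ≡ true → x ≢ x′ → arc D y x ≡ true → arc D y x′ ≡ true → ⊥) →
                     ∀ y → Y y ≡ true → h y + 1 ≤ c
          isolated {x} Xx alone y _ with arc D y x in yx
          ... | true = ≤-trans (+-monoˡ-≤ 1 (∣∣-≤1 {P = λ v → X v ∧ arc D y v}
                         (λ u v hu hv → trans (sym (is-x u hu)) (is-x v hv)))) 2≤c
            where
            is-x : ∀ v → X v ∧ arc D y v ≡ true → x ≡ v
            is-x v hv with x ≟ v
            ... | yes eq = eq
            ... | no x≢v = ⊥-elim (alone (proj₁ (∧-elim hv)) x≢v yx (proj₂ (∧-elim {X v} hv)))
          ... | false = ≤-trans (≤-reflexive (cong (h y +_) (sym (∣∣-｛｝ x))))
                (≤-trans (∣∣-disjoint {R = X} (λ v hv → proj₁ (∧-elim hv)) (λ v e → trans (cong X (sym (｛｝-true e))) Xx)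
                           (λ v hv e → true≢false (proj₂ (∧-elim {X v} hv)) (trans (cong (arc D y) (sym (｛｝-true e))) yx)))
                         (≤-reflexive (∣S∩∣ b)))

          by-light : ∀ p → ∣ L ∣ ≡ p → ⊥
          by-light zero p≡ = average-absurd c s Δ E (≤-trans (s≤s z≤n) 2≤c) a≡
            (subst₂ _≤_ (trans (cong (c * (3 * a + 1) +_) p≡) (+-identityʳ _))
              (trans (cong (λ p → 2 * Δ + p * a) p≡) (+-identityʳ _)) light-bound)
            E≤c² deficient
          by-light (suc zero) p≡ with member {P = L} (≤-reflexive (sym p≡))
          ... | x , Lx with any? (λ x′ → any? (λ y →
                  (X x′ Bool.≟ true) ×-dec (¬? (x ≟ x′) ×-dec ((arc D y x Bool.≟ true) ×-dec (arc D y x′ Bool.≟ true)))))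
          ...   | yes (x′ , y , Xx′ , x≢x′ , yx , yx′) =
            average-absurd c s Δ E (≤-trans (s≤s z≤n) 2≤c) a≡ (compensated Lx Xx′ x≢x′ yx yx′ only) E≤c² deficient
            where
            only : ∀ v → L v ≡ true → x ≡ v
            only v Lv with x ≟ v
            ... | yes eq = eq
            ... | no x≢v = ⊥-elim (≤-absurd 0 refl (subst (2 ≤_) p≡ (∣∣-≥2 x≢v Lx Lv)))
          ...   | no none = isolated-absurd c s Δ E (≤-trans (s≤s z≤n) 2≤c) a≡
            (subst (λ p → c * (3 * a + 1) + p ≤ 2 * Δ + p * a) p≡ light-bound)
            (E-bound 1 c (isolated (proj₁ (∧-elim Lx)) (λ Xx′ x≢x′ yx yx′ → none (_ , _ , Xx′ , x≢x′ , yx , yx′)))) deficient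
          by-light (suc (suc r)) p≡ =
            many-absurd c s Δ E (∣ L ∣) (≤-trans (s≤s (s≤s z≤n)) (≤-reflexive (sym p≡)))
              (≤-trans (∣∣-mono {P = L} {X} (λ v Lv → proj₁ (∧-elim Lv))) (≤-reflexive (∣S∩∣ b))) a≡
              light-bound (E-bound ∣ L ∣ (1 + c) h+∣L∣) deficient

      -- S is nonempty and `c` is not 1, so `2 ≤ c` and neither side is deficient; adding the two
      -- failures contradicts `upper-bound`.
      no-merge-absurd : ∀ v → S v ≡ true → c + c ≤ a → ⊥
      no-merge-absurd v Sv 2c≤a with m≤n⇒∃[o]m+o≡n 2c≤a
      ... | s , a≡ = ≤-absurd 1 (eq c a (Δ true) (Δ false) (E true) (E false))
          (+-mono-≤ (subst₂ (λ x y → x + (c + c) * c ≤ y + y + (c + c) * a) (∑[S]-parts d) (∑[S]-parts in-in) upper-bound)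
            (+-mono-≤ (≰⇒> (OneSide.not-deficient true 2≤c s a≡)) (≰⇒> (OneSide.not-deficient false 2≤c s a≡))))
        where
        2≤c : 2 ≤ c
        1≤c : 1 ≤ c
        1≤c = ≤-trans (∣∣-pos v (∧-intro Sv (side-part v))) (≤-reflexive (∣S∩∣ (side v)))
        2≤c = ≤∧≢⇒< 1≤c (c≢1 ∘ sym)
        Δ E : Bool → ℕ
        Δ b = ∑[ S∩ b ] d
        E b = ∑[ S∩ b ] in-in
        eq : ∀ c a Δ₁ Δ₂ E₁ E₂ →
             Δ₁ + Δ₂ + (c + c) * c + (suc (2 * E₁ + c * a) + suc (2 * E₂ + c * a)) ≡
             suc (E₁ + E₂ + (E₁ + E₂) + (c + c) * a + (Δ₁ + c * c + (Δ₂ + c * c)) + 1)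
        eq = solve-∀

    -- Merging orbits into a Hamiltonian cycle

    ArcPermutation : Permutation′ n → Set
    ArcPermutation σ = ∀ v → arc D v (σ ⟨$⟩ʳ v) ≡ true

    merging-arcs : ∀ σ → ArcPermutation σ → (B : Fin n → Bool) → (∀ v → B (σ ⟨$⟩ʳ v) ≡ B v) →
                   ∀ {x y} → B x ≡ true → B y ≡ false →
                   ∃₂ λ u w → B u ≡ true × B w ≡ false × arc D u (σ ⟨$⟩ʳ w) ≡ true × arc D w (σ ⟨$⟩ʳ u) ≡ true
    merging-arcs σ arcs B invariant {x} {y} Bx By
      with any? (λ u → any? (λ w → (B u Bool.≟ true) ×-dec ((B w Bool.≟ false) ×-dec
             ((arc D u (σ ⟨$⟩ʳ w) Bool.≟ true) ×-dec (arc D w (σ ⟨$⟩ʳ u) Bool.≟ true)))))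
    ... | yes found = found
    ... | no none with 2 * ∣ (λ v → B v ∧ side v) ∣ ≤? a
    ...   | yes small = ⊥-elim (Count.no-merge-absurd σ arcs B invariant
              (λ Bu Bw uw wu → none (_ , _ , Bu , Bw , uw , wu)) x Bx
              (≤-trans (≤-reflexive (cong (c +_) (sym (+-identityʳ c)))) small))
      where c = ∣ (λ v → B v ∧ side v) ∣
    -- The complement is invariant too and now has at most half of each side; the exchange condition
    -- is symmetric in `u` and `w`.
    ...   | no large = ⊥-elim (Count.no-merge-absurd σ arcs (not ∘ B) (cong not ∘ invariant)
              (λ Bu Bw uw wu → none (_ , _ , trans (sym (Bool.not-involutive _)) (cong not Bw) , not-true Bu , wu , uw))
              y (cong not By) (≤-from 1 (≰⇒> large) (trans (eq c₁ c₂) (cong (λ k → k + suc k) total))))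
      where
      c₁ = ∣ (λ v → B v ∧ side v) ∣
      c₂ = ∣ (λ v → not (B v) ∧ side v) ∣
      total : c₁ + c₂ ≡ a
      total = trans (cong₂ _+_ (∣∣-cong (λ v → Bool.∧-comm (B v) (side v)))
                               (∣∣-cong (λ v → Bool.∧-comm (not (B v)) (side v))))
                    (trans (sym (∣∣-split side B)) (∣part∣ true))
      eq : ∀ c₁ c₂ → c₂ + c₂ + 2 * c₁ + 1 ≡ c₁ + c₂ + suc (c₁ + c₂)
      eq = solve-∀

    -- If `σ v` lies in `B`, so does its forward orbit, which returns to `v`.
    closed⇒invariant : ∀ σ (B : Fin n → Bool) → (∀ v → B v ≡ true → B (σ ⟨$⟩ʳ v) ≡ true) → ∀ v → B (σ ⟨$⟩ʳ v) ≡ B v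
    closed⇒invariant σ B closed v with B v in Bv
    ... | true = closed v Bv
    ... | false = Bool.¬-not (λ h → true≢false (follow (Orbits.return (σ ⟨$⟩ʳ_) (perm-injective σ) v) h) Bv)
      where
      follow : ∀ {u v} → Orbit (σ ⟨$⟩ʳ_) u v → B u ≡ true → B v ≡ true
      follow ε Bu = Bu
      follow (refl ◅ path) Bu = follow path (closed _ Bu)

    -- `B` is the orbit of `v₀`. Each exchange enlarges it by at least `w`, while `k` bounds the
    -- number of vertices still outside.
    grow : ∀ k σ → ArcPermutation σ → (B : Fin n → Bool) (v₀ : Fin n) → B v₀ ≡ true →
           (∀ v → B v ≡ true → Orbit (σ ⟨$⟩ʳ_) v₀ v) → (∀ v → B v ≡ true → B (σ ⟨$⟩ʳ v) ≡ true) →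
           n ≤ k + ∣ B ∣ → Hamiltonian D
    grow k σ arcs B v₀ Bv₀ orbit closed enough with any? (λ y → B y Bool.≟ false)
    ... | no none = Orbits.spanning⇒hamiltonian (σ ⟨$⟩ʳ_) (perm-injective σ) D arcs v₀
                      (λ v → orbit v (¬false⇒true (λ e → none (v , e))))
    grow zero σ arcs B v₀ Bv₀ orbit closed enough | yes (y , By) =
      ⊥-elim (<⇒≱ (subst (∣ B ∣ <_) (∣∣-total B) (m<m+n ∣ B ∣ (∣∣-pos {P = not ∘ B} y (cong not By)))) enough)
    grow (suc k) σ arcs B v₀ Bv₀ orbit closed enough | yes (y , By)
      with merging-arcs σ arcs B (closed⇒invariant σ B closed) Bv₀ By
    ... | u , w , Bu , Bw , uw , wu
      -- Seeding the closure with `insert w B` makes the growth immediate; `start` shows that these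
      -- vertices lie in the merged orbit.
      with closure (λ p q → ｛ swap u w σ ⟨$⟩ʳ p ｝ q) (Orbit (swap u w σ ⟨$⟩ʳ_) v₀) (insert w B) start
             (λ p q path e → path ◅◅ (｛｝-true e ◅ ε))
      where
      open Merge σ B (closed⇒invariant σ B closed) Bu Bw
      start : ∀ v → insert w B v ≡ true → Orbit (σ′ ⟨$⟩ʳ_) v₀ v
      start v h with insert-elim w B v h
      ... | inj₁ refl = simulate (orbit u Bu) ◅◅ x⇝y
      ... | inj₂ Bv = simulate (orbit v Bv)
    ...   | B′ , grown , orbit′ , closed′ =
      grow k (swap u w σ) arcs′ B′ v₀ (grown v₀ (insert-⊇ w B v₀ Bv₀)) orbit′
        (λ v B′v → closed′ v _ B′v (｛｝-refl (swap u w σ ⟨$⟩ʳ v))) enough′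
      where
      arcs′ : ArcPermutation (swap u w σ)
      arcs′ v = at (v ≟ u) (v ≟ w)
        where
        at : Dec (v ≡ u) → Dec (v ≡ w) → arc D v (swap u w σ ⟨$⟩ʳ v) ≡ true
        at (yes refl) _ = trans (cong (arc D v) (swap-fst u w σ)) uw
        at (no _) (yes refl) = trans (cong (arc D v) (swap-snd u w σ)) wu
        at (no v≢u) (no v≢w) = trans (cong (arc D v) (swap-other u w σ v≢u v≢w)) (arcs v)
      enough′ : n ≤ k + ∣ B′ ∣
      enough′ = ≤-trans enough (≤-trans (≤-reflexive (trans (sym (+-suc k ∣ B ∣)) (cong (k +_) (sym (∣∣-insert w B Bw)))))
                  (+-monoʳ-≤ k (∣∣-mono grown)))

    hamiltonian : Fin n → Hamiltonian D
    hamiltonian v₀ with cycle-factor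
    ... | σ , arcs with closure (λ p q → ｛ σ ⟨$⟩ʳ p ｝ q) (Orbit (σ ⟨$⟩ʳ_) v₀) ｛ v₀ ｝
                          (λ v e → subst (Orbit (σ ⟨$⟩ʳ_) v₀) (｛｝-true e) ε)
                          (λ p q path e → path ◅◅ (｛｝-true e ◅ ε))
    ...   | B , start , orbit , closed =
      grow n σ arcs B v₀ (start v₀ (｛｝-refl v₀)) orbit (λ v Bv → closed v _ Bv (｛｝-refl (σ ⟨$⟩ʳ v))) (m≤m+n n ∣ B ∣)

-- Case distinction on the existence of an unpaired vertex

open Bipartite

theorem5p2 : (a : ℕ) → 2 ≤ a → (D : Digraph (a + a)) →
    StronglyConnected D → BalancedBipartite D a →
    (∀ u v → Dominated D u v → 3 * a + 1 ≤ deg D u + deg D v) →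
    Hamiltonian D
theorem5p2 zero ()
-- Matching on `suc` makes `zero` available as a starting vertex.
theorem5p2 a@(suc _) 2≤a D strong (side , crossing , ∣side∣ , ∣not-side∣) pairs
  with any? (λ v → ¬? (paired? a 2≤a D side crossing ∣side∣ ∣not-side∣ pairs v))
... | yes (v , unpaired) = unpaired⇒hamiltonian a 2≤a D side crossing ∣side∣ ∣not-side∣ pairs strong zero
        (λ u → unpaired-reach a 2≤a D side crossing ∣side∣ ∣not-side∣ pairs (strong u v) unpaired)
... | no none = AllPaired.hamiltonian a 2≤a D side crossing ∣side∣ ∣not-side∣ pairs
        (λ v → decidable-stable (paired? a 2≤a D side crossing ∣side∣ ∣not-side∣ pairs v)
                               (λ unpaired → none (v , unpaired))) zero
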